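{- For every $n\in\omega$, there is no Turing degree low${}_2$ over $\emptyset^{(n)}$ that bounds $\mathsf{STS}(n+2)$.
   Context: $\emptyset^{(n)}$ is the $n$-th jump of $\emptyset$. A set $X$ is low${}_2$ over $Y$ if $(X\oplus Y)''\leq_T Y''$. A degree bounds a principle if every computable instance of the principle has a solution computable in that degree. For $k\geq 1$, a coloring $g:[\omega]^{k+1}\to\omega$ is stable if for every $\sigma\in[\omega]^k$ the limit $\lim_s g(\sigma,s)$ exists. A set $A$ is thin for $g:[\omega]^k\to\omega$ if $g([A]^k)\neq\omega$. $\mathsf{STS}(k)$: every stable coloring $g:[\omega]^k\to\omega$ has an infinite set thin for $g$. -}

module Defs where

open import Data.Fin.Base using (Fin; toℕ)
open import Data.Fin.Properties using (toℕ-injective)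
open import Data.Irrelevant using ([_])
open import Data.Nat.Base using (ℕ; zero; suc; _+_; _*_; _≤_; _<_)
open import Data.Nat.GeneralisedArithmetic using (fold)
open import Data.Nat.Properties using (suc-injective; *-cancelˡ-≡; even≢odd)
open import Data.Product.Base using (Σ-syntax; ∃-syntax; _×_; _,_; proj₁)
open import Data.Refinement using (Refinement-syntax; value; _,_)
open import Data.Sum.Base using (_⊎_)
open import Data.Vec.Base using (Vec; []; _∷_; lookup; _∷ʳ_)
open import Data.Vec.Relation.Unary.All using (All)
open import Data.Vec.Relation.Unary.Linked using (Linked)
open import Level using (0ℓ) renaming (suc to lsuc)
open import Relation.Binary.PropositionalEquality
  using (_≡_; refl; sym; trans; cong; cong₂)
open import Relation.Nullary using (¬_; contradiction)
open import Relation.Unary using (Pred; ∅; _∈_; _∉_; Universal)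

private
  variable
    n k : ℕ

------------------------------------------------------------------------
-- Oracle computation: Kleene's μ-recursive functions with an oracle

data Code : ℕ → Set where
  zer    : Code 0
  succ   : Code 1
  proj   : Fin n → Code n
  comp   : Code k → Vec (Code n) k → Code n
  prec   : Code n → Code (2 + n) → Code (1 + n)
  mu     : Code (1 + n) → Code n
  oracle : Code 1

infix 4 _⊢_[_]⇓_

-- X ⊢ c [ xs ]⇓ y : program c with oracle X halts on input xs with
-- output y.  The oracle answers a query with the characteristic function
-- of X.
data _⊢_[_]⇓_ (X : Pred ℕ 0ℓ) : ∀ {n} → Code n → Vec ℕ n → ℕ → Set where
  ⇓zer   : X ⊢ zer [ [] ]⇓ 0
  ⇓succ  : ∀ {x} → X ⊢ succ [ x ∷ [] ]⇓ suc x
  ⇓proj  : ∀ {i : Fin n} {xs} → X ⊢ proj i [ xs ]⇓ lookup xs i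
  ⇓comp  : ∀ {f : Code k} {gs : Vec (Code n) k} {xs ys z} →
           (∀ i → X ⊢ lookup gs i [ xs ]⇓ lookup ys i) →
           X ⊢ f [ ys ]⇓ z →
           X ⊢ comp f gs [ xs ]⇓ z
  ⇓prec₀ : ∀ {f : Code n} {g xs y} →
           X ⊢ f [ xs ]⇓ y →
           X ⊢ prec f g [ 0 ∷ xs ]⇓ y
  ⇓precₛ : ∀ {f : Code n} {g xs m y z} →
           X ⊢ prec f g [ m ∷ xs ]⇓ y →
           X ⊢ g [ m ∷ y ∷ xs ]⇓ z →
           X ⊢ prec f g [ suc m ∷ xs ]⇓ z
  ⇓mu    : ∀ {f : Code (1 + n)} {xs m} →
           X ⊢ f [ m ∷ xs ]⇓ 0 →
           (∀ l → l < m → ∃[ y ] X ⊢ f [ l ∷ xs ]⇓ suc y) →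
           X ⊢ mu f [ xs ]⇓ m
  ⇓yes   : ∀ {x} → x ∈ X → X ⊢ oracle [ x ∷ [] ]⇓ 1
  ⇓no    : ∀ {x} → x ∉ X → X ⊢ oracle [ x ∷ [] ]⇓ 0

infix 4 _≤T_

_≤T_ : Pred ℕ 0ℓ → Pred ℕ 0ℓ → Set
A ≤T B = ∃[ c ] ∀ x → (x ∈ A → B ⊢ c [ x ∷ [] ]⇓ 1)
                    × (x ∉ A → B ⊢ c [ x ∷ [] ]⇓ 0)

------------------------------------------------------------------------
-- Gödel numbering, join and jump

-- ⟨ a , b ⟩ = 2 ^ a * (2 * b + 1)
⟨_,_⟩ : ℕ → ℕ → ℕ
⟨ zero  , b ⟩ = suc (2 * b)
⟨ suc a , b ⟩ = 2 * ⟨ a , b ⟩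

mutual
  ⌜_⌝ : Code n → ℕ
  ⌜ zer ⌝               = ⟨ 0 , 0 ⟩
  ⌜ succ ⌝              = ⟨ 1 , 0 ⟩
  ⌜ proj i ⌝            = ⟨ 2 , toℕ i ⟩
  ⌜ comp {k = k} f gs ⌝ = ⟨ 3 , ⟨ k , ⟨ ⌜ f ⌝ , ⌜ gs ⌝* ⟩ ⟩ ⟩
  ⌜ prec f g ⌝          = ⟨ 4 , ⟨ ⌜ f ⌝ , ⌜ g ⌝ ⟩ ⟩
  ⌜ mu f ⌝              = ⟨ 5 , ⌜ f ⌝ ⟩
  ⌜ oracle ⌝            = ⟨ 6 , 0 ⟩

  ⌜_⌝* : Vec (Code n) k → ℕ
  ⌜ [] ⌝*     = 0
  ⌜ g ∷ gs ⌝* = ⟨ ⌜ g ⌝ , ⌜ gs ⌝* ⟩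

⟨,⟩-injective : ∀ a b a′ b′ → ⟨ a , b ⟩ ≡ ⟨ a′ , b′ ⟩ → a ≡ a′ × b ≡ b′
⟨,⟩-injective zero    b zero     b′ eq =
  refl , *-cancelˡ-≡ b b′ 2 (suc-injective eq)
⟨,⟩-injective zero    b (suc a′) b′ eq =
  contradiction (sym eq) (even≢odd ⟨ a′ , b′ ⟩ b)
⟨,⟩-injective (suc a) b zero     b′ eq =
  contradiction eq (even≢odd ⟨ a , b ⟩ b′)
⟨,⟩-injective (suc a) b (suc a′) b′ eq
  with ⟨,⟩-injective a b a′ b′ (*-cancelˡ-≡ ⟨ a , b ⟩ ⟨ a′ , b′ ⟩ 2 eq)
... | p , q = cong suc p , q

private
  tag body : Code n → ℕ
  tag zer        = 0
  tag succ       = 1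
  tag (proj _)   = 2
  tag (comp _ _) = 3
  tag (prec _ _) = 4
  tag (mu _)     = 5
  tag oracle     = 6
  body zer                 = 0
  body succ                = 0
  body (proj i)            = toℕ i
  body (comp {k = k} f gs) = ⟨ k , ⟨ ⌜ f ⌝ , ⌜ gs ⌝* ⟩ ⟩
  body (prec f g)          = ⟨ ⌜ f ⌝ , ⌜ g ⌝ ⟩
  body (mu f)              = ⌜ f ⌝
  body oracle              = 0

  ⌜⌝-split : (c : Code n) → ⌜ c ⌝ ≡ ⟨ tag c , body c ⟩
  ⌜⌝-split zer        = refl
  ⌜⌝-split succ       = refl
  ⌜⌝-split (proj _)   = refl
  ⌜⌝-split (comp _ _) = refl
  ⌜⌝-split (prec _ _) = refl
  ⌜⌝-split (mu _)     = refl
  ⌜⌝-split oracle     = refl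

  split-≡ : (c d : Code n) → ⌜ c ⌝ ≡ ⌜ d ⌝ → tag c ≡ tag d × body c ≡ body d
  split-≡ c d eq = ⟨,⟩-injective (tag c) (body c) (tag d) (body d)
    (trans (sym (⌜⌝-split c)) (trans eq (⌜⌝-split d)))

mutual
  ⌜⌝-injective : (c d : Code n) → ⌜ c ⌝ ≡ ⌜ d ⌝ → c ≡ d
  ⌜⌝-injective c d eq with split-≡ c d eq
  ... | t , b = same c d t b

  private
    same : (c d : Code n) → tag c ≡ tag d → body c ≡ body d → c ≡ d
    same zer zer _ _ = refl
    same succ succ _ _ = refl
    same (proj i) (proj j) _ b = cong proj (toℕ-injective b)
    same (comp {k = k} f gs) (comp {k = l} f′ gs′) _ b
      with ⟨,⟩-injective k ⟨ ⌜ f ⌝ , ⌜ gs ⌝* ⟩ l ⟨ ⌜ f′ ⌝ , ⌜ gs′ ⌝* ⟩ b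
    ... | refl , b′ with ⟨,⟩-injective ⌜ f ⌝ ⌜ gs ⌝* ⌜ f′ ⌝ ⌜ gs′ ⌝* b′
    ... | p , q = cong₂ comp (⌜⌝-injective f f′ p) (⌜⌝*-injective gs gs′ q)
    same (prec f g) (prec f′ g′) _ b
      with ⟨,⟩-injective ⌜ f ⌝ ⌜ g ⌝ ⌜ f′ ⌝ ⌜ g′ ⌝ b
    ... | p , q = cong₂ prec (⌜⌝-injective f f′ p) (⌜⌝-injective g g′ q)
    same (mu f) (mu g) _ b = cong mu (⌜⌝-injective f g b)
    same oracle oracle _ _ = refl

  ⌜⌝*-injective : (gs hs : Vec (Code n) k) → ⌜ gs ⌝* ≡ ⌜ hs ⌝* → gs ≡ hs
  ⌜⌝*-injective []       []       _  = refl
  ⌜⌝*-injective (g ∷ gs) (h ∷ hs) eq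
    with ⟨,⟩-injective ⌜ g ⌝ ⌜ gs ⌝* ⌜ h ⌝ ⌜ hs ⌝* eq
  ... | p , q = cong₂ _∷_ (⌜⌝-injective g h p) (⌜⌝*-injective gs hs q)

-- Indices are programs with one input; numbers that are not the code of
-- such a program are not in the jump.
infix 25 _′

_′ : Pred ℕ 0ℓ → Pred ℕ 0ℓ
(X ′) e = Σ[ c ∈ Code 1 ] ⌜ c ⌝ ≡ e × ∃[ y ] X ⊢ c [ e ∷ [] ]⇓ y

infix 25 _⁽_⁾

_⁽_⁾ : Pred ℕ 0ℓ → ℕ → Pred ℕ 0ℓ
X ⁽ n ⁾ = fold X _′ n

infixr 6 _⊕_

_⊕_ : Pred ℕ 0ℓ → Pred ℕ 0ℓ → Pred ℕ 0ℓ
(A ⊕ B) x = (∃[ a ] x ≡ 2 * a × a ∈ A) ⊎ (∃[ b ] x ≡ suc (2 * b) × b ∈ B)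

infix 4 _Low₂Over_

_Low₂Over_ : Pred ℕ 0ℓ → Pred ℕ 0ℓ → Set
X Low₂Over Y = (X ⊕ Y) ′ ′ ≤T Y ′ ′

------------------------------------------------------------------------
-- Principles

record Principle : Set₁ where
  field
    Instance   : Set
    Computable : Instance → Set
    Solution   : Instance → Pred ℕ 0ℓ → Set

infix 4 _Bounds_

-- The degree is given by any set X belonging to it.
_Bounds_ : Pred ℕ 0ℓ → Principle → Set₁
X Bounds P = ∀ (I : Instance) → Computable I →
             ∃[ A ] A ≤T X × Solution I A
  where open Principle P

------------------------------------------------------------------------
-- The stable thin set principle

-- A k-element set of natural numbers is given by its strictly increasing
-- enumeration.
[ω]^_ : ℕ → Set
[ω]^ k = [ σ ∈ Vec ℕ k ∣ Linked _<_ σ ]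

Coloring : ℕ → Set
Coloring k = [ω]^ k → ℕ

ComputableColoring : Coloring k → Set
ComputableColoring {k} g = Σ[ c ∈ Code k ] ∀ σ → ∅ ⊢ c [ value σ ]⇓ g σ

-- g (σ , s) makes sense only for s > max σ; the premise inc enforces this,
-- and it holds for all large s.
Stable : Coloring (1 + k) → Set
Stable {k} g =
  ∀ (σ : [ω]^ k) → ∃[ v ] ∃[ s₀ ] ∀ s → s₀ ≤ s →
  (inc : Linked _<_ (value σ ∷ʳ s)) → g (value σ ∷ʳ s , [ inc ]) ≡ v

Infinite : Pred ℕ 0ℓ → Set
Infinite A = ∀ m → ∃[ x ] m ≤ x × x ∈ A

-- image g A is g([A]ᵏ)
image : Coloring k → Pred ℕ 0ℓ → Pred ℕ 0ℓ
image {k} g A v = Σ[ σ ∈ [ω]^ k ] All A (value σ) × g σ ≡ v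

Thin : Coloring k → Pred ℕ 0ℓ → Set
Thin g A = ¬ Universal (image g A)

-- STS[2+ n ] is STS(n + 2): stability needs colorings of arity at least 2.
STS[2+_] : ℕ → Principle
STS[2+ n ] = record
  { Instance   = Σ[ g ∈ Coloring (2 + n) ] Stable g
  ; Computable = λ (g , _) → ComputableColoring g
  ; Solution   = λ (g , _) A → Infinite A × Thin g A
  }

{-# OPTIONS --safe #-}

-- Let Y = ∅⁽ⁿ⁾ and suppose that (X ⊕ Y)″ ≤T Y″ while X bounds STS(n + 2).
-- By the limit lemma, iterated n + 1 times, every f ≤T Y′ is an iterated
-- limit of a computable stable coloring of arity n + 2, so X computes an
-- infinite set on which f omits some value.  For the a-th Y′-computable
-- function "the e-th X-c.e. set is infinite, and f omits the value i on it"
-- is Π₂ over X ⊕ Y, hence decidable in Y″; so Y″ finds the least such pair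
-- u = ⟨e,i⟩ from a, and by the limit lemma Y′ approximates it.  Applying
-- these approximations to their own index gives an f ≤T Y′ whose value f(s)
-- is the guess at stage s for the omitted i.  Then f is eventually equal to
-- a value that it omits on an infinite set.

module Submission where

open import Defs
open import Axiom.ExcludedMiddle using (ExcludedMiddle)
open import Data.Fin.Base using (Fin; zero; suc; toℕ; fromℕ; fromℕ<; inject₁; _↑ʳ_)
open import Data.Fin.Patterns using (0F; 1F; 2F; 3F; 4F; 5F)
open import Data.Fin.Properties using (toℕ-fromℕ<; toℕ<n)
open import Data.Irrelevant using ([_])
open import Data.List.Base using (List; []; _∷_; _++_)
open import Data.List.Relation.Unary.All as List using ([]; _∷_)
open import Data.List.Relation.Unary.All.Properties using (++⁻ˡ; ++⁻ʳ)
open import Data.Nat.Base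
open import Data.Nat.Properties
open import Data.Product.Base using (Σ-syntax; ∃-syntax; _×_; _,_; proj₁; proj₂)
open import Data.Refinement using (value; _,_)
open import Data.Sum.Base using (_⊎_; inj₁; inj₂)
open import Data.Vec.Base using (Vec; []; _∷_; _∷ʳ_; lookup; tabulate; map; drop; init; last; tail)
open import Data.Vec.Properties using (lookup∘tabulate; lookup-map; init-∷ʳ; last-∷ʳ)
open import Data.Vec.Relation.Unary.All using (All; []; _∷_)
open import Data.Vec.Relation.Unary.Linked using (Linked; [-]; _∷_)
open import Function.Base using (_∘_; id; _$_)
open import Level using (0ℓ)
open import Relation.Binary.Definitions using (tri<; tri≈; tri>)
open import Relation.Binary.PropositionalEquality
open import Relation.Nullary using (¬_; Dec; yes; no; contradiction)
open import Relation.Unary using (Pred; ∅; _∈_; _∉_)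

-- The difficulty is a circle: which pairs `u` are good depends on `f`, while `f` is computed from
-- approximations to goodness. A parameter cuts it. `goodᵗ` judges `u` against the program with an
-- arbitrary index `a`, run on `pair a m` so that it sees its own index; only afterwards does the
-- index of `guessᵗ` take the place of `a`. For other `a` that program may be partial, so goodness
-- is phrased as the absence of a refutation, which is Π₁ over `(X ⊕ Y) ′` whether or not the
-- program is total.
--
-- Thinness is applied to `f` only once, to produce some good pair: the reduction of the thin set to
-- `X` serves as `e`, the omitted color as `i`. Without a good pair the search for the least one
-- need not settle.
--
-- Because the jump is defined by concrete programs, Post's theorem and the limit lemma call for
-- actual codes: an evaluator of codes that is itself a code, a recogniser of Gödel numbers, and
-- indices of searches computed from their parameters.

private
  variable
    k l m n : ℕ
    A B X Z : Pred ℕ 0ℓ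

-- Determinism of oracle computations.

lookup-ext : (xs ys : Vec ℕ n) → (∀ i → lookup xs i ≡ lookup ys i) → xs ≡ ys
lookup-ext []       []       _  = refl
lookup-ext (x ∷ xs) (y ∷ ys) eq = cong₂ _∷_ (eq zero) (lookup-ext xs ys (eq ∘ suc))

⇓-det : {c : Code n} {xs : Vec ℕ n} {y z : ℕ} →
        X ⊢ c [ xs ]⇓ y → X ⊢ c [ xs ]⇓ z → y ≡ z
⇓-det ⇓zer ⇓zer = refl
⇓-det ⇓succ ⇓succ = refl
⇓-det ⇓proj ⇓proj = refl
⇓-det (⇓comp {ys = ys} hs d) (⇓comp {ys = zs} hs′ d′)
  with refl ← lookup-ext ys zs (λ i → ⇓-det (hs i) (hs′ i)) = ⇓-det d d′
⇓-det (⇓prec₀ d) (⇓prec₀ d′) = ⇓-det d d′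
⇓-det (⇓precₛ d e) (⇓precₛ d′ e′) with refl ← ⇓-det d d′ = ⇓-det e e′
⇓-det (⇓mu {m = m} d h) (⇓mu {m = l} d′ h′) with <-cmp m l
... | tri< m<l _ _ = contradiction (⇓-det d (proj₂ (h′ m m<l))) λ ()
... | tri≈ _ m≡l _ = m≡l
... | tri> _ _ l<m = contradiction (⇓-det d′ (proj₂ (h l l<m))) λ ()
⇓-det (⇓yes _) (⇓yes _) = refl
⇓-det (⇓yes p) (⇓no ¬p) = contradiction p ¬p
⇓-det (⇓no ¬p) (⇓yes p) = contradiction p ¬p
⇓-det (⇓no _) (⇓no _) = refl

-- Total functions computable from an oracle

record Term (X : Pred ℕ 0ℓ) (n : ℕ) : Set where
  constructor term
  field
    ⟦_⟧  : Vec ℕ n → ℕ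
    code : Code n
    runs : ∀ xs → X ⊢ code [ xs ]⇓ ⟦_⟧ xs

open Term public

record Sub (X : Pred ℕ 0ℓ) (m n : ℕ) : Set where
  constructor sub
  field
    ⟦_⟧*  : Vec ℕ m → Vec ℕ n
    codes : Vec (Code m) n
    runs* : ∀ xs i → X ⊢ lookup codes i [ xs ]⇓ lookup (⟦_⟧* xs) i

open Sub public

-- Changes the recorded function but keeps the code, so that later goals speak of `_+_` or `least`
-- and not of `natrec`.
fun≗ : (t : Term X n) (f : Vec ℕ n → ℕ) → (∀ xs → ⟦ t ⟧ xs ≡ f xs) → Term X n
fun≗ {X = X} t f eq =
  term f (code t) λ xs → subst (X ⊢ code t [ xs ]⇓_) (eq xs) (runs t xs)

infixr 5 _∷ˢ_

[]ˢ : Sub X n 0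
[]ˢ = sub (λ _ → []) [] λ _ ()

_∷ˢ_ : Term X m → Sub X m n → Sub X m (suc n)
t ∷ˢ s = sub (λ xs → ⟦ t ⟧ xs ∷ ⟦ s ⟧* xs) (code t ∷ codes s)
  λ { xs zero → runs t xs ; xs (suc i) → runs* s xs i }

projections : (ρ : Fin n → Fin m) (f : Vec ℕ m → Vec ℕ n) →
              (∀ xs i → lookup xs (ρ i) ≡ lookup (f xs) i) → Sub X m n
projections {X = X} ρ f eq = sub f (tabulate (proj ∘ ρ)) λ xs i →
  subst₂ (X ⊢_[ xs ]⇓_) (sym (lookup∘tabulate _ i)) (eq xs i) ⇓proj

dropˢ : ∀ k → Sub X (k + n) n
dropˢ k = projections (k ↑ʳ_) (drop k) (lookup-drop k)
  where
  lookup-drop : ∀ k (xs : Vec ℕ (k + n)) i → lookup xs (k ↑ʳ i) ≡ lookup (drop k xs) i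
  lookup-drop zero    xs       i = refl
  lookup-drop (suc k) (x ∷ xs) i = lookup-drop k xs i

initˢ : Sub X (suc n) n
initˢ = projections inject₁ init lookup-init
  where
  lookup-init : ∀ {n} (xs : Vec ℕ (suc n)) i → lookup xs (inject₁ i) ≡ lookup (init xs) i
  lookup-init (x ∷ xs) zero    = refl
  lookup-init (x ∷ xs) (suc i) = lookup-init xs i

infixl 9 _⟪_⟫

_⟪_⟫ : Term X n → Sub X m n → Term X m
t ⟪ s ⟫ = term (λ xs → ⟦ t ⟧ (⟦ s ⟧* xs)) (comp (code t) (codes s))
  λ xs → ⇓comp (runs* s xs) (runs t (⟦ s ⟧* xs))

var : Fin n → Term X n
var i = term (λ xs → lookup xs i) (proj i) λ _ → ⇓proj

lastᵗ : Term X (suc n)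
lastᵗ = fun≗ (var (fromℕ _)) last lookup-last
  where
  lookup-last : ∀ {n} (xs : Vec ℕ (suc n)) → lookup xs (fromℕ n) ≡ last xs
  lookup-last (x ∷ [])     = refl
  lookup-last (x ∷ y ∷ xs) = lookup-last (y ∷ xs)

sucᵗ : Term X n → Term X n
sucᵗ t = term (λ xs → suc (⟦ t ⟧ xs)) (comp succ (code t ∷ []))
  λ xs → ⇓comp {ys = ⟦ t ⟧ xs ∷ []} (λ { zero → runs t xs }) ⇓succ

numeral : ℕ → Code n
numeral zero    = comp zer []
numeral (suc x) = comp succ (numeral x ∷ [])

numeral-runs : ∀ x (xs : Vec ℕ n) → X ⊢ numeral x [ xs ]⇓ x
numeral-runs zero    xs = ⇓comp {ys = []} (λ ()) ⇓zer
numeral-runs (suc x) xs = ⇓comp {ys = x ∷ []} (λ { zero → numeral-runs x xs }) ⇓succ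

const : ℕ → Term X n
const x = term (λ _ → x) (numeral x) (numeral-runs x)

natrec : ℕ → (ℕ → ℕ → ℕ) → ℕ → ℕ
natrec z s zero    = z
natrec z s (suc m) = s m (natrec z s m)

-- The number of rounds is a term over the same variables, so that recursions nest freely; `dropˢ 0`
-- is the identity substitution.
recᵗ : Term X n → Term X n → Term X (2 + n) → Term X n
recᵗ {X} {n} c z s =
  term _ (code (rec ⟪ c ∷ˢ dropˢ 0 ⟫)) (runs (rec ⟪ c ∷ˢ dropˢ 0 ⟫))
  where
  recurse : ∀ m xs → X ⊢ prec (code z) (code s) [ m ∷ xs ]⇓
            natrec (⟦ z ⟧ xs) (λ m y → ⟦ s ⟧ (m ∷ y ∷ xs)) m
  recurse zero    xs = ⇓prec₀ (runs z xs)
  recurse (suc m) xs = ⇓precₛ (recurse m xs) (runs s _)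

  rec : Term X (suc n)
  rec = term (λ { (m ∷ xs) → natrec (⟦ z ⟧ xs) (λ m y → ⟦ s ⟧ (m ∷ y ∷ xs)) m })
    (prec (code z) (code s)) λ { (m ∷ xs) → recurse m xs }

-- Arithmetic.  As a truth value, 0 stands for true.

ifz : ℕ → ℕ → ℕ → ℕ
ifz zero    x y = x
ifz (suc _) x y = y

ifzᵗ : Term X n → Term X n → Term X n → Term X n
ifzᵗ c t u = fun≗ (recᵗ c t (u ⟪ dropˢ 2 ⟫)) (λ xs → ifz (⟦ c ⟧ xs) (⟦ t ⟧ xs) (⟦ u ⟧ xs))
  λ xs → eq (⟦ c ⟧ xs) (⟦ t ⟧ xs) (⟦ u ⟧ xs)
  where
  eq : ∀ c x y → natrec x (λ _ _ → y) c ≡ ifz c x y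
  eq zero    x y = refl
  eq (suc c) x y = refl

predᵗ : Term X n → Term X n
predᵗ t = fun≗ (recᵗ t (const 0) (var 0F)) (λ xs → pred (⟦ t ⟧ xs)) λ xs → eq (⟦ t ⟧ xs)
  where
  eq : ∀ x → natrec 0 (λ m _ → m) x ≡ pred x
  eq zero    = refl
  eq (suc x) = refl

infixl 6 _+ᵗ_ _∸ᵗ_
infixl 7 _*ᵗ_

_+ᵗ_ : Term X n → Term X n → Term X n
t +ᵗ u = fun≗ (recᵗ t u (sucᵗ (var 1F))) (λ xs → ⟦ t ⟧ xs + ⟦ u ⟧ xs) λ xs → eq (⟦ t ⟧ xs) _
  where
  eq : ∀ x y → natrec y (λ _ → suc) x ≡ x + y
  eq zero    y = refl
  eq (suc x) y = cong suc (eq x y)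

_*ᵗ_ : Term X n → Term X n → Term X n
t *ᵗ u = fun≗ (recᵗ t (const 0) (u ⟪ dropˢ 2 ⟫ +ᵗ var 1F)) (λ xs → ⟦ t ⟧ xs * ⟦ u ⟧ xs)
  λ xs → eq (⟦ t ⟧ xs) _
  where
  eq : ∀ x y → natrec 0 (λ _ → y +_) x ≡ x * y
  eq zero    y = refl
  eq (suc x) y = cong (y +_) (eq x y)

_∸ᵗ_ : Term X n → Term X n → Term X n
t ∸ᵗ u = fun≗ (recᵗ u t (predᵗ (var 1F))) (λ xs → ⟦ t ⟧ xs ∸ ⟦ u ⟧ xs) λ xs → eq _ (⟦ u ⟧ xs)
  where
  eq : ∀ x y → natrec x (λ _ → pred) y ≡ x ∸ y
  eq x zero    = refl
  eq x (suc y) = trans (cong pred (eq x y)) (pred[m∸n]≡m∸[1+n] x y)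

-- The equality test under the convention that 0 is true. Under it `_+_` acts as conjunction, `_*_`
-- as disjunction and `neg` as negation.
dist : ℕ → ℕ → ℕ
dist x y = (x ∸ y) + (y ∸ x)

distᵗ : Term X n → Term X n → Term X n
distᵗ t u = (t ∸ᵗ u) +ᵗ (u ∸ᵗ t)

dist-refl : ∀ x → dist x x ≡ 0
dist-refl x = cong₂ _+_ (n∸n≡0 x) (n∸n≡0 x)

dist≡0⇒≡ : ∀ x y → dist x y ≡ 0 → x ≡ y
dist≡0⇒≡ x y eq = ≤-antisym (m∸n≡0⇒m≤n (m+n≡0⇒m≡0 (x ∸ y) eq))
                            (m∸n≡0⇒m≤n (m+n≡0⇒n≡0 (x ∸ y) eq))

neg : ℕ → ℕ
neg x = 1 ∸ x

neg≡0⇒≢0 : ∀ x → neg x ≡ 0 → x ≢ 0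
neg≡0⇒≢0 (suc _) _ ()

≢0⇒neg≡0 : ∀ x → x ≢ 0 → neg x ≡ 0
≢0⇒neg≡0 zero    x≢0 = contradiction refl x≢0
≢0⇒neg≡0 (suc x) _   = 0∸n≡0 x

negᵗ : Term X n → Term X n
negᵗ t = const 1 ∸ᵗ t

switch : ℕ → List ℕ → ℕ
switch _       []       = 0
switch zero    (x ∷ _)  = x
switch (suc i) (_ ∷ xs) = switch i xs

switchᵗ : Term X n → List (Term X n) → Term X n
switchᵗ {X} {n} t us = fun≗ (go t us) (λ xs → switch (⟦ t ⟧ xs) (vals us xs)) (go-ok t us)
  where
  vals : List (Term X n) → Vec ℕ n → List ℕ
  vals []       xs = []
  vals (u ∷ us) xs = ⟦ u ⟧ xs ∷ vals us xs

  go : Term X n → List (Term X n) → Term X n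
  go t []       = const 0
  go t (u ∷ us) = ifzᵗ t u (go (predᵗ t) us)

  go-ok : ∀ t us xs → ⟦ go t us ⟧ xs ≡ switch (⟦ t ⟧ xs) (vals us xs)
  go-ok t []       xs with ⟦ t ⟧ xs
  ... | zero  = refl
  ... | suc _ = refl
  go-ok t (u ∷ us) xs with ⟦ t ⟧ xs | go-ok (predᵗ t) us xs
  ... | zero  | _  = refl
  ... | suc i | eq = eq

-- least b f is b when f has no zero below b.

least : ℕ → (ℕ → ℕ) → ℕ
least zero    f = 0
least (suc b) f = ifz (f (least b f)) (least b f) (suc (least b f))

-- Up to `m` the result moves with the bound; from there on it is frozen, because the test at `m` is
-- zero.
least-≡ : ∀ b (f : ℕ → ℕ) m → m ≤ b → f m ≡ 0 → (∀ l → l < m → f l ≢ 0) → least b f ≡ m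
least-≡ b f m m≤b fm≡0 min with m≤n⇒∃[o]m+o≡n m≤b
... | d , refl = trans (cong (λ b → least b f) (+-comm m d)) (after d)
  where
  before : ∀ b → b ≤ m → least b f ≡ b
  before zero    _   = refl
  before (suc b) b<m rewrite before b (<⇒≤ b<m) with f b | min b b<m
  ... | zero  | fb≢0 = contradiction refl fb≢0
  ... | suc _ | _    = refl

  after : ∀ d → least (d + m) f ≡ m
  after zero    = before m ≤-refl
  after (suc d) rewrite after d | fm≡0 = refl

leastᵗ : Term X n → Term X (suc n) → Term X n
leastᵗ b t = fun≗ (recᵗ b (const 0)
    (ifzᵗ (t ⟪ var 1F ∷ˢ dropˢ 2 ⟫) (var 1F) (sucᵗ (var 1F))))
  (λ xs → least (⟦ b ⟧ xs) (λ i → ⟦ t ⟧ (i ∷ xs))) λ xs → eq (⟦ b ⟧ xs) _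
  where
  eq : ∀ b (f : ℕ → ℕ) → natrec 0 (λ _ y → ifz (f y) y (suc y)) b ≡ least b f
  eq zero    f = refl
  eq (suc b) f rewrite eq b f = refl

minimal : ∀ (f : ℕ → ℕ) m → f m ≡ 0 → ∃[ l ] f l ≡ 0 × ∀ i → i < l → f i ≢ 0
minimal f zero    f0   = 0 , f0 , λ _ ()
minimal f (suc m) fm with f 0 ≟ 0
... | yes f0 = 0 , f0 , λ _ ()
... | no f0 with minimal (f ∘ suc) m fm
... | l , fl , min = suc l , fl , λ { zero _ → f0 ; (suc i) (s≤s i<l) → min i i<l }

-- Pairing

left<⟨,⟩ : ∀ a b → a < ⟨ a , b ⟩
left<⟨,⟩ zero    b = s≤s z≤n
left<⟨,⟩ (suc a) b = ≤-trans (s≤s (left<⟨,⟩ a b))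
  (≤-trans (+-monoˡ-≤ ⟨ a , b ⟩ (≤-trans (s≤s z≤n) (left<⟨,⟩ a b)))
    (≤-reflexive (cong (⟨ a , b ⟩ +_) (sym (+-identityʳ ⟨ a , b ⟩)))))

right<⟨,⟩ : ∀ a b → b < ⟨ a , b ⟩
right<⟨,⟩ zero    b = s≤s (m≤m+n b (b + 0))
right<⟨,⟩ (suc a) b = ≤-trans (right<⟨,⟩ a b) (m≤m+n ⟨ a , b ⟩ _)

-- Unpairing by bounded search: `z` is a sufficient bound because both components lie below their
-- pair. For a wrong first component of a pair `search₂` returns its bound, and the test in
-- `search₁` rejects the result.
search₂ : ℕ → ℕ → ℕ
search₂ a z = least z (λ b → dist ⟨ a , b ⟩ z)

search₁ : ℕ → ℕ
search₁ z = least z (λ a → dist ⟨ a , search₂ a z ⟩ z)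

search₂-⟨,⟩ : ∀ a b → search₂ a ⟨ a , b ⟩ ≡ b
search₂-⟨,⟩ a b = least-≡ _ _ b (<⇒≤ (right<⟨,⟩ a b)) (dist-refl ⟨ a , b ⟩)
  λ l l<b eq → <⇒≢ l<b (proj₂ (⟨,⟩-injective a l a b (dist≡0⇒≡ _ _ eq)))

search₁-⟨,⟩ : ∀ a b → search₁ ⟨ a , b ⟩ ≡ a
search₁-⟨,⟩ a b = least-≡ _ _ a (<⇒≤ (left<⟨,⟩ a b))
  (trans (cong (λ c → dist ⟨ a , c ⟩ ⟨ a , b ⟩) (search₂-⟨,⟩ a b)) (dist-refl ⟨ a , b ⟩))
  λ l l<a eq → <⇒≢ l<a (proj₁ (⟨,⟩-injective l (search₂ l ⟨ a , b ⟩) a b (dist≡0⇒≡ _ _ eq)))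

⟨,⟩ᵗ : Term X n → Term X n → Term X n
⟨,⟩ᵗ t u = fun≗ (recᵗ t (sucᵗ (const 2 *ᵗ u)) (const 2 *ᵗ var 1F))
  (λ xs → ⟨ ⟦ t ⟧ xs , ⟦ u ⟧ xs ⟩) λ xs → eq (⟦ t ⟧ xs) _
  where
  eq : ∀ a b → natrec (suc (2 * b)) (λ _ y → 2 * y) a ≡ ⟨ a , b ⟩
  eq zero    b = refl
  eq (suc a) b = cong (2 *_) (eq a b)

search₂ᵗ : Term X n → Term X n → Term X n
search₂ᵗ t u = leastᵗ u (distᵗ (⟨,⟩ᵗ (t ⟪ dropˢ 1 ⟫) (var 0F)) (u ⟪ dropˢ 1 ⟫))

search₁ᵗ : Term X n → Term X n
search₁ᵗ t = leastᵗ t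
  (distᵗ (⟨,⟩ᵗ (var 0F) (search₂ᵗ (var 0F) (t ⟪ dropˢ 1 ⟫))) (t ⟪ dropˢ 1 ⟫))

-- Opacity keeps ⟨ 3 , x ⟩ and the like from unfolding to arithmetic.
opaque
  pair : ℕ → ℕ → ℕ
  pair = ⟨_,_⟩

  π₁ π₂ : ℕ → ℕ
  π₁ = search₁
  π₂ z = search₂ (search₁ z) z

  π₁-pair : ∀ a b → π₁ (pair a b) ≡ a
  π₁-pair = search₁-⟨,⟩

  π₂-pair : ∀ a b → π₂ (pair a b) ≡ b
  π₂-pair a b = trans (cong (λ c → search₂ c ⟨ a , b ⟩) (search₁-⟨,⟩ a b)) (search₂-⟨,⟩ a b)

  pair-injective₁ : ∀ {a b a′ b′} → pair a b ≡ pair a′ b′ → a ≡ a′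
  pair-injective₁ eq = proj₁ (⟨,⟩-injective _ _ _ _ eq)

  pair-injective₂ : ∀ {a b a′ b′} → pair a b ≡ pair a′ b′ → b ≡ b′
  pair-injective₂ {a} {b} {a′} {b′} eq = proj₂ (⟨,⟩-injective a b a′ b′ eq)

  pair≢0 : ∀ a b → pair a b ≢ 0
  pair≢0 a b eq with left<⟨,⟩ a b
  ... | lt rewrite eq with () ← lt

  pairᵒ : (t u : Term X n) → Σ[ c ∈ Code n ] ∀ xs → X ⊢ c [ xs ]⇓ pair (⟦ t ⟧ xs) (⟦ u ⟧ xs)
  pairᵒ t u = _ , runs (⟨,⟩ᵗ t u)

  π₁ᵒ : (t : Term X n) → Σ[ c ∈ Code n ] ∀ xs → X ⊢ c [ xs ]⇓ π₁ (⟦ t ⟧ xs)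
  π₁ᵒ t = _ , runs (search₁ᵗ t)

  π₂ᵒ : (t : Term X n) → Σ[ c ∈ Code n ] ∀ xs → X ⊢ c [ xs ]⇓ π₂ (⟦ t ⟧ xs)
  π₂ᵒ t = _ , runs (search₂ᵗ (search₁ᵗ t) t)

pairᵗ : Term X n → Term X n → Term X n
pairᵗ t u = term (λ xs → pair (⟦ t ⟧ xs) (⟦ u ⟧ xs)) (proj₁ (pairᵒ t u)) (proj₂ (pairᵒ t u))

π₁ᵗ π₂ᵗ : Term X n → Term X n
π₁ᵗ t = term (λ xs → π₁ (⟦ t ⟧ xs)) (proj₁ (π₁ᵒ t)) (proj₂ (π₁ᵒ t))
π₂ᵗ t = term (λ xs → π₂ (⟦ t ⟧ xs)) (proj₁ (π₂ᵒ t)) (proj₂ (π₂ᵒ t))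

-- Peels off the first step, not the last, to suit inductions that follow a run from its initial
-- state.
iterate : (ℕ → ℕ) → ℕ → ℕ → ℕ
iterate f x zero    = x
iterate f x (suc s) = iterate f (f x) s

iterateᵗ : Term X n → Term X n → Term X 1 → Term X n
iterateᵗ s t f = fun≗ (recᵗ s t (f ⟪ var 1F ∷ˢ []ˢ ⟫))
  (λ xs → iterate (λ x → ⟦ f ⟧ (x ∷ [])) (⟦ t ⟧ xs) (⟦ s ⟧ xs)) λ xs → eq _ _ (⟦ s ⟧ xs)
  where
  comm : ∀ (f : ℕ → ℕ) x s → natrec (f x) (λ _ → f) s ≡ f (natrec x (λ _ → f) s)
  comm f x zero    = refl
  comm f x (suc s) = cong f (comm f x s)

  eq : ∀ (f : ℕ → ℕ) x s → natrec x (λ _ → f) s ≡ iterate f x s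
  eq f x zero    = refl
  eq f x (suc s) = trans (sym (comm f x s)) (eq f (f x) s)

-- Gödel numbers in terms of the opaque pairing.

opaque
  unfolding pair

  # : Code n → ℕ
  # = ⌜_⌝

  #* : Vec (Code n) k → ℕ
  #* = ⌜_⌝*

  #-≡ : (c : Code n) → ⌜ c ⌝ ≡ # c
  #-≡ c = refl

  #-injective : (c d : Code n) → # c ≡ # d → c ≡ d
  #-injective = ⌜⌝-injective

  #-zer : # zer ≡ pair 0 0
  #-zer = refl

  #-succ : # succ ≡ pair 1 0
  #-succ = refl

  #-proj : (i : Fin n) → # (proj i) ≡ pair 2 (toℕ i)
  #-proj i = refl

  #-comp : (f : Code k) (gs : Vec (Code n) k) →
           # (comp f gs) ≡ pair 3 (pair k (pair (# f) (#* gs)))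
  #-comp f gs = refl

  #-prec : (f : Code n) (g : Code (2 + n)) → # (prec f g) ≡ pair 4 (pair (# f) (# g))
  #-prec f g = refl

  #-mu : (f : Code (suc n)) → # (mu f) ≡ pair 5 (# f)
  #-mu f = refl

  #-oracle : # oracle ≡ pair 6 0
  #-oracle = refl

  #*-[] : #* {n} [] ≡ 0
  #*-[] = refl

  #*-∷ : (g : Code n) (gs : Vec (Code n) k) → #* (g ∷ gs) ≡ pair (# g) (#* gs)
  #*-∷ g gs = refl

indicator : {P : Set} → Dec P → ℕ
indicator (yes _) = 1
indicator (no _)  = 0

-- A stack machine evaluating codes

data Sort : Set where
  nat : Sort
  vec : ℕ → Sort

private
  variable
    ι : Sort

Val : Sort → Set
Val nat     = ℕ
Val (vec k) = Vec ℕ k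

-- The stack of pending work; the index tells whether a number or a vector is awaited. `argK` awaits
-- one argument, `consK` holds it while the remaining ones are evaluated, and `muK f l` awaits the
-- test of the candidate `l`.
data Cont : Sort → Set where
  done   : Cont nat
  argK   : Vec (Code n) k → Vec ℕ n → Cont (vec (suc k)) → Cont nat
  precK  : Code (2 + n) → ℕ → Vec ℕ n → Cont nat → Cont nat
  muK    : Code (1 + n) → ℕ → Vec ℕ n → Cont nat → Cont nat
  applyK : Code k → Cont nat → Cont (vec k)
  consK  : ℕ → Cont (vec (suc k)) → Cont (vec k)

data State : Set where
  ev  : Code n → Vec ℕ n → Cont nat → State
  evs : Vec (Code n) k → Vec ℕ n → Cont (vec k) → State
  ret : Cont ι → Val ι → State

encV : Vec ℕ n → ℕ
encV []       = 0
encV (x ∷ xs) = pair x (encV xs)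

encVal : ∀ ι → Val ι → ℕ
encVal nat     y  = y
encVal (vec k) ys = encV ys

-- One layout, padded with 0, serves all frames, so the arithmetic step can unpack a frame before
-- looking at its tag. `done` is coded as `pair 0 0`; for its tag only the returned value is read.
frame : (t p q r κ : ℕ) → ℕ
frame t p q r κ = pair t (pair p (pair q (pair r κ)))

encK : Cont ι → ℕ
encK done             = pair 0 0
encK (argK gs xs κ)   = frame 1 (#* gs) (encV xs) 0 (encK κ)
encK (precK g m xs κ) = frame 2 (# g) (encV xs) m (encK κ)
encK (muK f l xs κ)   = frame 3 (# f) (encV xs) l (encK κ)
encK (applyK f κ)     = frame 4 (# f) 0 0 (encK κ)
encK (consK y κ)      = frame 5 0 0 y (encK κ)

state : (mode a b κ : ℕ) → ℕ
state mode a b κ = pair mode (pair a (pair b κ))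

enc : State → ℕ
enc (ev c xs κ)       = state 0 (# c) (encV xs) (encK κ)
enc (evs gs xs κ)     = state 1 (#* gs) (encV xs) (encK κ)
enc (ret {ι = ι} κ v) = state 2 (encVal ι v) 0 (encK κ)

frameᵗ : (t p q r κ : Term X n) → Term X n
frameᵗ t p q r κ = pairᵗ t (pairᵗ p (pairᵗ q (pairᵗ r κ)))

stateᵗ : (mode a b κ : Term X n) → Term X n
stateᵗ mode a b κ = pairᵗ mode (pairᵗ a (pairᵗ b κ))

ifz-pair : ∀ {a b x y} → ifz (pair a b) x y ≡ y
ifz-pair {a} {b} with pair a b | pair≢0 a b
... | zero  | ≢0 = contradiction refl ≢0
... | suc _ | _  = refl

-- The stack machine simulated in arithmetic, and its correctness.

module _ (em : ExcludedMiddle 0ℓ) where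

  χ : Pred ℕ 0ℓ → ℕ → ℕ
  χ X x = indicator (em {x ∈ X})

  χ-runs : ∀ x → X ⊢ oracle [ x ∷ [] ]⇓ χ X x
  χ-runs {X} x with em {x ∈ X}
  ... | yes x∈X = ⇓yes x∈X
  ... | no x∉X = ⇓no x∉X

  χᵗ : Term X n → Term X n
  χᵗ {X} t = term (λ { (x ∷ []) → χ X x }) oracle (λ { (x ∷ []) → χ-runs x }) ⟪ t ∷ˢ []ˢ ⟫

  χ-det : ∀ {x y} → X ⊢ oracle [ x ∷ [] ]⇓ y → χ X x ≡ y
  χ-det d = ⇓-det (χ-runs _) d

  module Machine (X : Pred ℕ 0ℓ) where

    step : State → State
    step (ev zer [] κ)              = ret κ 0
    step (ev succ (x ∷ []) κ)       = ret κ (suc x)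
    step (ev (proj i) xs κ)         = ret κ (lookup xs i)
    step (ev (comp f gs) xs κ)      = evs gs xs (applyK f κ)
    step (ev (prec f g) (zero ∷ xs) κ)  = ev f xs κ
    step (ev (prec f g) (suc m ∷ xs) κ) = ev (prec f g) (m ∷ xs) (precK g m xs κ)
    step (ev (mu f) xs κ)           = ev f (0 ∷ xs) (muK f 0 xs κ)
    step (ev oracle (x ∷ []) κ)     = ret κ (χ X x)
    step (evs [] xs κ)              = ret κ []
    step (evs (g ∷ gs) xs κ)        = ev g xs (argK gs xs κ)
    step (ret done y)               = ret done y
    step (ret (argK gs xs κ) y)     = evs gs xs (consK y κ)
    step (ret (precK g m xs κ) y)   = ev g (m ∷ y ∷ xs) κ
    step (ret (muK f l xs κ) zero)  = ret κ l
    step (ret (muK f l xs κ) (suc y)) = ev f (suc l ∷ xs) (muK f (suc l) xs κ)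
    step (ret (applyK f κ) ys)      = ev f ys κ
    step (ret (consK y κ) ys)       = ret κ (y ∷ ys)

    nthᵗ : Term X n → Term X n → Term X n
    nthᵗ i t = π₁ᵗ (iterateᵗ i t (π₂ᵗ (var 0F)))

    nth-encV : (xs : Vec ℕ n) (i : Fin n) →
               π₁ (iterate π₂ (encV xs) (toℕ i)) ≡ lookup xs i
    nth-encV (x ∷ xs) zero    = π₁-pair x (encV xs)
    nth-encV (x ∷ xs) (suc i) rewrite π₂-pair x (encV xs) = nth-encV xs i

    evᵗ : Term X 4
    evᵗ = switchᵗ tag
      ( retᵗ (const 0)
      ∷ retᵗ (sucᵗ (π₁ᵗ xs))
      ∷ retᵗ (nthᵗ body xs)
      ∷ stateᵗ (const 1) (π₂ᵗ (π₂ᵗ body)) xs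
          (frameᵗ (const 4) (π₁ᵗ (π₂ᵗ body)) (const 0) (const 0) κ)
      ∷ ifzᵗ (π₁ᵗ xs)
          (stateᵗ (const 0) (π₁ᵗ body) (π₂ᵗ xs) κ)
          -- The recursion is rescheduled with a smaller counter, so the Gödel number of the `prec`
          -- code is reassembled from its tag 4 and its body.
          (stateᵗ (const 0) (pairᵗ (const 4) body) (pairᵗ (predᵗ (π₁ᵗ xs)) (π₂ᵗ xs))
            (frameᵗ (const 2) (π₂ᵗ body) (π₂ᵗ xs) (predᵗ (π₁ᵗ xs)) κ))
      ∷ stateᵗ (const 0) body (pairᵗ (const 0) xs) (frameᵗ (const 3) body xs (const 0) κ)
      ∷ retᵗ (χᵗ (π₁ᵗ xs))
      ∷ [])
      where
      tag body xs κ : Term X 4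
      tag  = var 0F
      body = var 1F
      xs   = var 2F
      κ    = var 3F
      retᵗ : Term X 4 → Term X 4
      retᵗ y = stateᵗ (const 2) y (const 0) κ

    evsᵗ : Term X 3
    evsᵗ = ifzᵗ gs
        (stateᵗ (const 2) (const 0) (const 0) κ)
        (stateᵗ (const 0) (π₁ᵗ gs) xs (frameᵗ (const 1) (π₂ᵗ gs) xs (const 0) κ))
      where
      gs xs κ : Term X 3
      gs = var 0F
      xs = var 1F
      κ  = var 2F

    retᵗ : Term X 6
    retᵗ = switchᵗ tag
      ( stateᵗ (const 2) y (const 0) (pairᵗ (const 0) (const 0))
      ∷ stateᵗ (const 1) p q (frameᵗ (const 5) (const 0) (const 0) y κ)
      ∷ stateᵗ (const 0) p (pairᵗ r (pairᵗ y q)) κ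
      ∷ ifzᵗ y
          (stateᵗ (const 2) r (const 0) κ)
          (stateᵗ (const 0) p (pairᵗ (sucᵗ r) q) (frameᵗ (const 3) p q (sucᵗ r) κ))
      ∷ stateᵗ (const 0) p y κ
      ∷ stateᵗ (const 2) (pairᵗ r y) (const 0) κ
      ∷ [])
      where
      y tag p q r κ : Term X 6
      y   = var 0F
      tag = var 1F
      p   = var 2F
      q   = var 3F
      r   = var 4F
      κ   = var 5F

    dispatchᵗ : Term X 4
    dispatchᵗ = switchᵗ (var 0F)
      ( evᵗ ⟪ π₁ᵗ a ∷ˢ π₂ᵗ a ∷ˢ b ∷ˢ κ ∷ˢ []ˢ ⟫
      ∷ evsᵗ ⟪ a ∷ˢ b ∷ˢ κ ∷ˢ []ˢ ⟫
      ∷ retᵗ ⟪ a ∷ˢ π₁ᵗ κ ∷ˢ π₁ᵗ (π₂ᵗ κ) ∷ˢ π₁ᵗ (π₂ᵗ (π₂ᵗ κ)) ∷ˢ π₁ᵗ (π₂ᵗ (π₂ᵗ (π₂ᵗ κ)))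
             ∷ˢ π₂ᵗ (π₂ᵗ (π₂ᵗ (π₂ᵗ κ))) ∷ˢ []ˢ ⟫
      ∷ [])
      where
      a b κ : Term X 4
      a = var 1F
      b = var 2F
      κ = var 3F

    stepᵗ : Term X 1
    stepᵗ = dispatchᵗ ⟪ π₁ᵗ σ ∷ˢ π₁ᵗ (π₂ᵗ σ) ∷ˢ π₁ᵗ (π₂ᵗ (π₂ᵗ σ)) ∷ˢ π₂ᵗ (π₂ᵗ (π₂ᵗ σ)) ∷ˢ []ˢ ⟫
      where
      σ : Term X 1
      σ = var 0F

    stepℕ : ℕ → ℕ
    stepℕ x = ⟦ stepᵗ ⟧ (x ∷ [])

    stepℕ-state : ∀ mode a b κ →
      stepℕ (state mode a b κ) ≡ ⟦ dispatchᵗ ⟧ (mode ∷ a ∷ b ∷ κ ∷ [])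
    stepℕ-state mode a b κ
      rewrite π₂-pair mode (pair a (pair b κ)) | π₂-pair a (pair b κ) | π₂-pair b κ
            | π₁-pair mode (pair a (pair b κ)) | π₁-pair a (pair b κ) | π₁-pair b κ = refl

    stepℕ-ev : ∀ t b xs κ →
      stepℕ (state 0 (pair t b) xs κ) ≡ ⟦ evᵗ ⟧ (t ∷ b ∷ xs ∷ κ ∷ [])
    stepℕ-ev t b xs κ = trans (stepℕ-state 0 (pair t b) xs κ)
      (cong₂ (λ t b → ⟦ evᵗ ⟧ (t ∷ b ∷ xs ∷ κ ∷ [])) (π₁-pair t b) (π₂-pair t b))

    stepℕ-frame : ∀ t p q r κ y →
      stepℕ (state 2 y 0 (frame t p q r κ)) ≡ ⟦ retᵗ ⟧ (y ∷ t ∷ p ∷ q ∷ r ∷ κ ∷ [])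
    stepℕ-frame t p q r κ y rewrite stepℕ-state 2 y 0 (frame t p q r κ)
            | π₂-pair t (pair p (pair q (pair r κ))) | π₁-pair t (pair p (pair q (pair r κ)))
            | π₂-pair p (pair q (pair r κ)) | π₁-pair p (pair q (pair r κ))
            | π₂-pair q (pair r κ) | π₁-pair q (pair r κ)
            | π₂-pair r κ | π₁-pair r κ = refl

    stepℕ-code : ∀ (c : Code n) t b xs κ → # c ≡ pair t b →
      stepℕ (state 0 (# c) xs κ) ≡ ⟦ evᵗ ⟧ (t ∷ b ∷ xs ∷ κ ∷ [])
    stepℕ-code c t b xs κ eq = trans (cong (λ e → stepℕ (state 0 e xs κ)) eq) (stepℕ-ev t b xs κ)

    -- Turns runs of the typed machine into runs on numbers; each case is the projection laws
    -- followed by evaluation of `switch`.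
    stepℕ-enc : ∀ σ → stepℕ (enc σ) ≡ enc (step σ)
    stepℕ-enc (ev zer [] κ) = stepℕ-code zer _ _ _ _ #-zer
    stepℕ-enc (ev succ (x ∷ []) κ) = trans (stepℕ-code succ _ _ _ _ #-succ)
      (cong (λ y → state 2 (suc y) 0 (encK κ)) (π₁-pair x 0))
    stepℕ-enc (ev (proj i) xs κ) = trans (stepℕ-code (proj i) _ _ _ _ (#-proj i))
      (cong (λ y → state 2 y 0 (encK κ)) (nth-encV xs i))
    stepℕ-enc (ev (comp {k = k} f gs) xs κ) =
      trans (stepℕ-code (comp f gs) _ _ _ _ (#-comp f gs)) eq
      where
      eq : ⟦ evᵗ ⟧ (3 ∷ pair k (pair (# f) (#* gs)) ∷ encV xs ∷ encK κ ∷ []) ≡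
           state 1 (#* gs) (encV xs) (frame 4 (# f) 0 0 (encK κ))
      eq rewrite π₂-pair k (pair (# f) (#* gs))
               | π₁-pair (# f) (#* gs) | π₂-pair (# f) (#* gs) = refl
    stepℕ-enc (ev (prec f g) (zero ∷ xs) κ) =
      trans (stepℕ-code (prec f g) _ _ _ _ (#-prec f g)) eq
      where
      eq : ⟦ evᵗ ⟧ (4 ∷ pair (# f) (# g) ∷ encV (0 ∷ xs) ∷ encK κ ∷ []) ≡
           state 0 (# f) (encV xs) (encK κ)
      eq rewrite π₁-pair 0 (encV xs) | π₂-pair 0 (encV xs) | π₁-pair (# f) (# g) = refl
    stepℕ-enc (ev (prec f g) (suc m ∷ xs) κ) =
      trans (stepℕ-code (prec f g) _ _ _ _ (#-prec f g)) eq
      where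
      eq : ⟦ evᵗ ⟧ (4 ∷ pair (# f) (# g) ∷ encV (suc m ∷ xs) ∷ encK κ ∷ []) ≡
           state 0 (# (prec f g)) (pair m (encV xs)) (frame 2 (# g) (encV xs) m (encK κ))
      eq rewrite π₁-pair (suc m) (encV xs) | π₂-pair (suc m) (encV xs)
               | π₂-pair (# f) (# g) | #-prec f g = refl
    stepℕ-enc (ev (mu f) xs κ) = stepℕ-code (mu f) _ _ _ _ (#-mu f)
    stepℕ-enc (ev oracle (x ∷ []) κ) = trans (stepℕ-code oracle _ _ _ _ #-oracle)
      (cong (λ y → state 2 (χ X y) 0 (encK κ)) (π₁-pair x 0))
    stepℕ-enc (evs {n = n} [] xs κ) = trans (stepℕ-state 1 _ _ _) eq
      where
      eq : ⟦ evsᵗ ⟧ (#* {n} [] ∷ encV xs ∷ encK κ ∷ []) ≡ state 2 0 0 (encK κ)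
      eq rewrite #*-[] {n} = refl
    stepℕ-enc (evs (g ∷ gs) xs κ) = trans (stepℕ-state 1 _ _ _) eq
      where
      eq : ⟦ evsᵗ ⟧ (#* (g ∷ gs) ∷ encV xs ∷ encK κ ∷ []) ≡
           state 0 (# g) (encV xs) (frame 1 (#* gs) (encV xs) 0 (encK κ))
      eq rewrite #*-∷ g gs = trans (ifz-pair {# g} {#* gs}) eq′
        where
        eq′ : state 0 (π₁ (pair (# g) (#* gs))) (encV xs)
                (frame 1 (π₂ (pair (# g) (#* gs))) (encV xs) 0 (encK κ)) ≡ _
        eq′ rewrite π₁-pair (# g) (#* gs) | π₂-pair (# g) (#* gs) = refl
    stepℕ-enc (ret done y) = trans (stepℕ-state 2 _ _ _) eq
      where
      eq : ⟦ dispatchᵗ ⟧ (2 ∷ y ∷ 0 ∷ pair 0 0 ∷ []) ≡ state 2 y 0 (pair 0 0)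
      eq rewrite π₁-pair 0 0 = refl
    stepℕ-enc (ret (argK gs xs κ) y) = stepℕ-frame _ _ _ _ _ _
    stepℕ-enc (ret (precK g m xs κ) y) = stepℕ-frame _ _ _ _ _ _
    stepℕ-enc (ret (muK f l xs κ) zero) = stepℕ-frame _ _ _ _ _ _
    stepℕ-enc (ret (muK f l xs κ) (suc y)) = stepℕ-frame _ _ _ _ _ _
    stepℕ-enc (ret (applyK f κ) ys) = stepℕ-frame _ _ _ _ _ _
    stepℕ-enc (ret (consK y κ) ys) = stepℕ-frame _ _ _ _ _ _

    -- The invariant of a `mu`-search that has reached the candidate `l`: the answer is the first
    -- zero from `l` on.
    Root : Code (suc n) → Vec ℕ n → ℕ → ℕ → Set
    Root f xs l m = l ≤ m × X ⊢ f [ m ∷ xs ]⇓ 0 ×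
                    (∀ j → l ≤ j → j < m → ∃[ y ] X ⊢ f [ j ∷ xs ]⇓ suc y)

    Args : Vec (Code n) k → Vec ℕ n → Vec ℕ k → Set
    Args gs xs ys = ∀ i → X ⊢ lookup gs i [ xs ]⇓ lookup ys i

    -- Resumes κ v z: read as big-step evaluation, the frames of κ take v to z.
    Resumes : Cont ι → Val ι → ℕ → Set
    Resumes done             y z = y ≡ z
    Resumes (argK gs xs κ)   y z = ∃[ ys ] Args gs xs ys × Resumes κ (y ∷ ys) z
    Resumes (precK g m xs κ) y z = ∃[ w ] X ⊢ g [ m ∷ y ∷ xs ]⇓ w × Resumes κ w z
    Resumes (muK f l xs κ)   y z = ∃[ m ] Resumes κ m z ×
      (y ≡ 0 × l ≡ m ⊎ ∃[ y′ ] y ≡ suc y′ × Root f xs (suc l) m)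
    Resumes (applyK f κ)    ys z = ∃[ w ] X ⊢ f [ ys ]⇓ w × Resumes κ w z
    Resumes (consK y κ)     ys z = Resumes κ (y ∷ ys) z

    Yields : State → ℕ → Set
    Yields (ev c xs κ)   z = ∃[ y ] X ⊢ c [ xs ]⇓ y × Resumes κ y z
    Yields (evs gs xs κ) z = ∃[ ys ] Args gs xs ys × Resumes κ ys z
    Yields (ret κ v)     z = Resumes κ v z

    mu-root : (f : Code (suc n)) (xs : Vec ℕ n) (l m : ℕ) {y : ℕ} → X ⊢ f [ l ∷ xs ]⇓ y →
              (y ≡ 0 × l ≡ m ⊎ ∃[ y′ ] y ≡ suc y′ × Root f xs (suc l) m) → Root f xs l m
    mu-root f xs l m d (inj₁ (refl , refl)) =
      ≤-refl , d , λ j l≤j j<l → contradiction (≤-<-trans l≤j j<l) (<-irrefl refl)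
    mu-root f xs l m d (inj₂ (y′ , refl , l<m , root , above)) = <⇒≤ l<m , root , from
      where
      from : ∀ j → l ≤ j → j < m → ∃[ y ] X ⊢ f [ j ∷ xs ]⇓ suc y
      from j l≤j j<m with m≤n⇒m<n∨m≡n l≤j
      ... | inj₁ l<j  = above j l<j j<m
      ... | inj₂ refl = y′ , d

    -- Meaning is carried backwards along a run. The last state has an evident result, from which
    -- the result of every pending evaluation is recovered.
    step-sound : ∀ σ {z} → Yields (step σ) z → Yields σ z
    step-sound (ev zer [] κ) r = 0 , ⇓zer , r
    step-sound (ev succ (x ∷ []) κ) r = suc x , ⇓succ , r
    step-sound (ev (proj i) xs κ) r = lookup xs i , ⇓proj , r
    step-sound (ev (comp f gs) xs κ) (ys , ds , w , d , r) = w , ⇓comp ds d , r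
    step-sound (ev (prec f g) (zero ∷ xs) κ) (y , d , r) = y , ⇓prec₀ d , r
    step-sound (ev (prec f g) (suc m ∷ xs) κ) (y , d , w , e , r) = w , ⇓precₛ d e , r
    step-sound (ev (mu f) xs κ) (y , d , m , r , alt) with mu-root f xs 0 m d alt
    ... | _ , root , below = m , ⇓mu root (λ l → below l z≤n) , r
    step-sound (ev oracle (x ∷ []) κ) r = χ X x , χ-runs x , r
    step-sound (evs [] xs κ) r = [] , (λ ()) , r
    step-sound (evs (g ∷ gs) xs κ) (y , d , ys , ds , r) =
      y ∷ ys , (λ { zero → d ; (suc i) → ds i }) , r
    step-sound (ret done y) r = r
    step-sound (ret (argK gs xs κ) y) r = r
    step-sound (ret (precK g m xs κ) y) r = r
    step-sound (ret (muK f l xs κ) zero) r = l , r , inj₁ (refl , refl)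
    step-sound (ret (muK f l xs κ) (suc y)) (y′ , d , m , r , alt) =
      m , r , inj₂ (y , refl , mu-root f xs (suc l) m d alt)
    step-sound (ret (applyK f κ) ys) r = r
    step-sound (ret (consK y κ) ys) r = r

    infix 4 _⟶*_

    data _⟶*_ : State → State → Set where
      stop : ∀ {σ} → σ ⟶* σ
      next : ∀ σ {τ} → step σ ⟶* τ → σ ⟶* τ

    ⟶*-trans : ∀ {σ τ υ} → σ ⟶* τ → τ ⟶* υ → σ ⟶* υ
    ⟶*-trans stop       q = q
    ⟶*-trans (next σ p) q = next σ (⟶*-trans p q)

    evs-complete : (gs : Vec (Code n) k) (xs : Vec ℕ n) (ys : Vec ℕ k) →
                   (∀ i κ → ev (lookup gs i) xs κ ⟶* ret κ (lookup ys i)) →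
                   ∀ κ → evs gs xs κ ⟶* ret κ ys
    evs-complete []       xs []       h κ = next _ stop
    evs-complete (g ∷ gs) xs (y ∷ ys) h κ = next _ (⟶*-trans (h zero (argK gs xs κ))
      (next _ (⟶*-trans (evs-complete gs xs ys (h ∘ suc) (consK y κ)) (next _ stop))))

    -- Induction on the distance `d` from the candidate `l` to the root `m`.
    mu-complete : (f : Code (suc n)) (xs : Vec ℕ n) (m : ℕ) →
                  (∀ κ → ev f (m ∷ xs) κ ⟶* ret κ 0) →
                  (∀ l → l < m → ∃[ y ] ∀ κ → ev f (l ∷ xs) κ ⟶* ret κ (suc y)) →
                  ∀ κ d l → d + l ≡ m → ev f (l ∷ xs) (muK f l xs κ) ⟶* ret κ m
    mu-complete f xs m root below κ zero    l refl = ⟶*-trans (root (muK f l xs κ)) (next _ stop)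
    mu-complete f xs m root below κ (suc d) l refl with below l (s≤s (m≤n+m l d))
    ... | y , h = ⟶*-trans (h (muK f l xs κ))
      (next _ (mu-complete f xs m root below κ d (suc l) (+-suc d l)))

    -- The stack `κ` is arbitrary so that the induction hypotheses apply beneath the frames that a
    -- subcomputation pushes.
    complete : {c : Code n} {xs : Vec ℕ n} {y : ℕ} →
               X ⊢ c [ xs ]⇓ y → ∀ κ → ev c xs κ ⟶* ret κ y
    complete ⇓zer κ = next _ stop
    complete ⇓succ κ = next _ stop
    complete ⇓proj κ = next _ stop
    complete (⇓comp {gs = gs} {xs} {ys} ds d) κ = next _
      (⟶*-trans (evs-complete gs xs ys (λ i → complete (ds i)) (applyK _ κ))
        (next _ (complete d κ)))
    complete (⇓prec₀ d) κ = next _ (complete d κ)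
    complete (⇓precₛ d e) κ = next _ (⟶*-trans (complete d (precK _ _ _ κ)) (next _ (complete e κ)))
    complete (⇓mu {f = f} {xs} {m} d h) κ = next _ (mu-complete f xs m (complete d)
      (λ l l<m → proj₁ (h l l<m) , complete (proj₂ (h l l<m))) κ m 0 (+-identityʳ m))
    complete d@(⇓yes {x} _) κ = next (ev oracle (x ∷ []) κ) (subst (λ y → ret κ y ⟶* ret κ 1) (sym (χ-det d)) stop)
    complete d@(⇓no {x} _) κ = next (ev oracle (x ∷ []) κ) (subst (λ y → ret κ y ⟶* ret κ 0) (sym (χ-det d)) stop)

    final : ℕ → ℕ
    final y = enc (ret done y)

    -- The mode and the frame tag tell states apart: only a `ret` onto an empty stack has this code.
    final-yields : ∀ σ y → enc σ ≡ final y → Yields σ y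
    final-yields (ev c xs κ) y eq = contradiction (pair-injective₁ eq) λ ()
    final-yields (evs gs xs κ) y eq = contradiction (pair-injective₁ eq) λ ()
    final-yields (ret κ v) y eq = go κ v (pair-injective₁ (pair-injective₂ eq))
        (pair-injective₂ (pair-injective₂ (pair-injective₂ eq)))
      where
      go : (κ : Cont ι) (v : Val ι) → encVal ι v ≡ y → encK κ ≡ pair 0 0 → Resumes κ v y
      go done             v eq _ = eq
      go (argK gs xs κ)   v _ eq = contradiction (pair-injective₁ eq) λ ()
      go (precK g m xs κ) v _ eq = contradiction (pair-injective₁ eq) λ ()
      go (muK f l xs κ)   v _ eq = contradiction (pair-injective₁ eq) λ ()
      go (applyK f κ)     v _ eq = contradiction (pair-injective₁ eq) λ ()
      go (consK y κ)      v _ eq = contradiction (pair-injective₁ eq) λ ()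

    iterate-sound : ∀ s σ y → iterate stepℕ (enc σ) s ≡ final y → Yields σ y
    iterate-sound zero    σ y eq = final-yields σ y eq
    iterate-sound (suc s) σ y eq = step-sound σ (iterate-sound s (step σ) y
      (trans (cong (λ x → iterate stepℕ x s) (sym (stepℕ-enc σ))) eq))

    iterate-complete : ∀ {σ τ} → σ ⟶* τ → ∃[ s ] iterate stepℕ (enc σ) s ≡ enc τ
    iterate-complete stop = 0 , refl
    iterate-complete (next σ p) with iterate-complete p
    ... | s , eq = suc s , trans (cong (λ x → iterate stepℕ x s) (stepℕ-enc σ)) eq

    initial : ℕ → ℕ → ℕ
    initial e x = state 0 e (pair x 0) (pair 0 0)

    halts⇒⇓ : ∀ s (c : Code 1) x y → iterate stepℕ (initial (# c) x) s ≡ final y → X ⊢ c [ x ∷ [] ]⇓ y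
    halts⇒⇓ s c x y eq with iterate-sound s (ev c (x ∷ []) done) y eq
    ... | _ , d , refl = d

    ⇓⇒halts : ∀ {c : Code 1} {x y} → X ⊢ c [ x ∷ [] ]⇓ y →
              ∃[ s ] iterate stepℕ (initial (# c) x) s ≡ final y
    ⇓⇒halts d = iterate-complete (complete d done)

-- A machine recognising the Gödel numbers of well-formed codes

data Task : Set where
  isCode  : (n e : ℕ) → Task
  isCodes : (n k e : ℕ) → Task

-- The evaluator accepts any number, but the jump contains only codes of one-input programs, so
-- well-formedness has to be tested separately. A Gödel number does not record the input arity, so
-- each task carries it.
Valid : Task → Set
Valid (isCode n e)    = Σ[ c ∈ Code n ] # c ≡ e
Valid (isCodes n k e) = Σ[ gs ∈ Vec (Code n) k ] #* gs ≡ e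

encTask : Task → ℕ
encTask (isCode n e)    = pair 0 (pair n (pair 0 e))
encTask (isCodes n k e) = pair 1 (pair n (pair k e))

encTasks : List Task → ℕ
encTasks []       = 0
encTasks (t ∷ ts) = pair (encTask t) (encTasks ts)

module Checker (X : Pred ℕ 0ℓ) where

  isCodeᵗ : Term X n → Term X n → Term X n
  isCodeᵗ n e = pairᵗ (const 0) (pairᵗ n (pairᵗ (const 0) e))

  isCodesᵗ : Term X n → Term X n → Term X n → Term X n
  isCodesᵗ n k e = pairᵗ (const 1) (pairᵗ n (pairᵗ k e))

  -- A task that fails its test stays on the list for ever.
  codeStepᵗ : Term X 4
  -- Beyond its table `switch` returns 0, which codes the empty list and would count as success;
  -- tags above 6 are therefore diverted to `w`.
  codeStepᵗ = ifzᵗ (tag ∸ᵗ const 6) (switchᵗ tag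
      ( ifzᵗ (ar +ᵗ distᵗ e (pairᵗ (const 0) (const 0))) ts w
      ∷ ifzᵗ (distᵗ ar (const 1) +ᵗ distᵗ e (pairᵗ (const 1) (const 0))) ts w
      ∷ ifzᵗ ((sucᵗ b ∸ᵗ ar) +ᵗ distᵗ e (pairᵗ (const 2) b)) ts w
      ∷ ifzᵗ (distᵗ e (pairᵗ (const 3) (pairᵗ b₁ (pairᵗ b₂ b₃))))
          (pairᵗ (isCodeᵗ b₁ b₂) (pairᵗ (isCodesᵗ ar b₁ b₃) ts)) w
      ∷ ifzᵗ ((const 1 ∸ᵗ ar) +ᵗ distᵗ e (pairᵗ (const 4) (pairᵗ b₁ (π₂ᵗ b))))
          (pairᵗ (isCodeᵗ (predᵗ ar) b₁) (pairᵗ (isCodeᵗ (sucᵗ ar) (π₂ᵗ b)) ts)) w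
      ∷ ifzᵗ (distᵗ e (pairᵗ (const 5) b)) (pairᵗ (isCodeᵗ (sucᵗ ar) b) ts) w
      ∷ ifzᵗ (distᵗ ar (const 1) +ᵗ distᵗ e (pairᵗ (const 6) (const 0))) ts w
      ∷ [])) w
    where
    ar e ts w tag b b₁ b₂ b₃ : Term X 4
    ar   = var 0F
    e   = var 1F
    ts  = var 2F
    w   = var 3F
    tag = π₁ᵗ e
    b   = π₂ᵗ e
    b₁  = π₁ᵗ b
    b₂  = π₁ᵗ (π₂ᵗ b)
    b₃  = π₂ᵗ (π₂ᵗ b)

  codesStepᵗ : Term X (suc 4)
  codesStepᵗ = ifzᵗ len
      (ifzᵗ e ts w)
      -- The projections are total, so a number that is not a pair is recognised by pairing its
      -- projections again.
      (ifzᵗ (distᵗ e (pairᵗ (π₁ᵗ e) (π₂ᵗ e)))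
        (pairᵗ (isCodeᵗ ar (π₁ᵗ e)) (pairᵗ (isCodesᵗ ar (predᵗ len) (π₂ᵗ e)) ts)) w)
    where
    ar len e ts w : Term X (suc 4)
    ar  = var 0F
    len  = var 1F
    e  = var 2F
    ts = var 3F
    w  = var 4F

  taskStepᵗ : Term X (2 + 4)
  taskStepᵗ = switchᵗ (var 0F)
    ( codeStepᵗ ⟪ var 1F ∷ˢ dropˢ 3 ⟫
    ∷ codesStepᵗ ⟪ dropˢ 1 ⟫
    ∷ [])

  stepᵗ : Term X 1
  stepᵗ = ifzᵗ w (const 0) (taskStepᵗ ⟪ π₁ᵗ t ∷ˢ π₁ᵗ (π₂ᵗ t) ∷ˢ π₁ᵗ (π₂ᵗ (π₂ᵗ t)) ∷ˢ
      π₂ᵗ (π₂ᵗ (π₂ᵗ t)) ∷ˢ π₂ᵗ w ∷ˢ w ∷ˢ []ˢ ⟫)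
    where
    w t : Term X 1
    w = var 0F
    t = π₁ᵗ w

  stepℕ : ℕ → ℕ
  stepℕ x = ⟦ stepᵗ ⟧ (x ∷ [])

  codeStep : (n e ts w : ℕ) → ℕ
  codeStep n e ts w = ⟦ codeStepᵗ ⟧ (n ∷ e ∷ ts ∷ w ∷ [])

  codesStep : (n k e ts w : ℕ) → ℕ
  codesStep n k e ts w = ⟦ codesStepᵗ ⟧ (n ∷ k ∷ e ∷ ts ∷ w ∷ [])

  taskStep : (task ts w : ℕ) → ℕ
  taskStep t ts w =
    ⟦ taskStepᵗ ⟧ (π₁ t ∷ π₁ (π₂ t) ∷ π₁ (π₂ (π₂ t)) ∷ π₂ (π₂ (π₂ t)) ∷ ts ∷ w ∷ [])

  stepℕ-∷ : ∀ t ts → stepℕ (encTasks (t ∷ ts)) ≡ taskStep (encTask t) (encTasks ts) (encTasks (t ∷ ts))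
  stepℕ-∷ t ts = trans (ifz-pair {encTask t} {encTasks ts})
    (cong₂ (λ u us → taskStep u us (encTasks (t ∷ ts)))
      (π₁-pair (encTask t) (encTasks ts)) (π₂-pair (encTask t) (encTasks ts)))

  stepℕ-isCode : ∀ n e ts →
    stepℕ (encTasks (isCode n e ∷ ts)) ≡ codeStep n e (encTasks ts) (encTasks (isCode n e ∷ ts))
  stepℕ-isCode n e ts = trans (stepℕ-∷ (isCode n e) ts) (eq (encTasks ts) _)
    where
    eq : ∀ ts w → taskStep (encTask (isCode n e)) ts w ≡ codeStep n e ts w
    eq ts w rewrite π₁-pair 0 (pair n (pair 0 e)) | π₂-pair 0 (pair n (pair 0 e))
                  | π₁-pair n (pair 0 e) | π₂-pair n (pair 0 e) | π₂-pair 0 e = refl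

  stepℕ-isCodes : ∀ n k e ts →
    stepℕ (encTasks (isCodes n k e ∷ ts)) ≡
    codesStep n k e (encTasks ts) (encTasks (isCodes n k e ∷ ts))
  stepℕ-isCodes n k e ts = trans (stepℕ-∷ (isCodes n k e) ts) (eq (encTasks ts) _)
    where
    eq : ∀ ts w → taskStep (encTask (isCodes n k e)) ts w ≡ codesStep n k e ts w
    eq ts w rewrite π₁-pair 1 (pair n (pair k e)) | π₂-pair 1 (pair n (pair k e))
                  | π₁-pair n (pair k e) | π₂-pair n (pair k e) | π₁-pair k e | π₂-pair k e = refl

  Outcome : Task → List Task → (w r : ℕ) → Set
  Outcome t ts w r =
    r ≡ w ⊎ Σ[ subs ∈ List Task ] r ≡ encTasks (subs ++ ts) × (List.All Valid subs → Valid t)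

  guard : ∀ t ts c w subs → (c ≡ 0 → List.All Valid subs → Valid t) →
          Outcome t ts w (ifz c (encTasks (subs ++ ts)) w)
  guard t ts zero    w subs v = inj₂ (subs , refl , v refl)
  guard t ts (suc _) w subs v = inj₁ refl

  codeStep-outcome : ∀ n e ts w → Outcome (isCode n e) ts w (codeStep n e (encTasks ts) w)
  codeStep-outcome n e ts w with π₁ e
  ... | 0 = guard (isCode n e) ts (n + dist e (pair 0 0)) w [] λ c0 _ → zer-valid n
              (m+n≡0⇒m≡0 n c0) (dist≡0⇒≡ _ _ (m+n≡0⇒n≡0 n c0))
    where
    zer-valid : ∀ n → n ≡ 0 → e ≡ pair 0 0 → Valid (isCode n e)
    zer-valid _ refl eq = zer , trans #-zer (sym eq)
  ... | 1 = guard (isCode n e) ts (dist n 1 + dist e (pair 1 0)) w [] λ c0 _ → succ-valid n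
              (dist≡0⇒≡ _ _ (m+n≡0⇒m≡0 (dist n 1) c0)) (dist≡0⇒≡ _ _ (m+n≡0⇒n≡0 (dist n 1) c0))
    where
    succ-valid : ∀ n → n ≡ 1 → e ≡ pair 1 0 → Valid (isCode n e)
    succ-valid _ refl eq = succ , trans #-succ (sym eq)
  ... | 2 = guard (isCode n e) ts ((suc (π₂ e) ∸ n) + dist e (pair 2 (π₂ e))) w [] λ c0 _ →
              let i<n = m∸n≡0⇒m≤n (m+n≡0⇒m≡0 (suc (π₂ e) ∸ n) c0) in
              proj (fromℕ< i<n) , trans (#-proj (fromℕ< i<n))
                (trans (cong (pair 2) (toℕ-fromℕ< i<n))
                  (sym (dist≡0⇒≡ _ _ (m+n≡0⇒n≡0 (suc (π₂ e) ∸ n) c0))))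
  ... | 3 = guard (isCode n e) ts (dist e (pair 3 (pair len (pair (π₁ (π₂ (π₂ e))) (π₂ (π₂ (π₂ e))))))) w
              (isCode len _ ∷ isCodes n len _ ∷ []) λ { c0 ((f , eqf) ∷ (gs , eqgs) ∷ []) →
              comp f gs , trans (#-comp f gs)
                (trans (cong₂ (λ x y → pair 3 (pair len (pair x y))) eqf eqgs) (sym (dist≡0⇒≡ _ _ c0))) }
    where len = π₁ (π₂ e)
  ... | 4 = guard (isCode n e) ts ((1 ∸ n) + dist e (pair 4 (pair (π₁ (π₂ e)) (π₂ (π₂ e))))) w
              (isCode (pred n) _ ∷ isCode (suc n) _ ∷ []) λ { c0 (vf ∷ vg ∷ []) → prec-valid n
              (m∸n≡0⇒m≤n (m+n≡0⇒m≡0 (1 ∸ n) c0)) (dist≡0⇒≡ _ _ (m+n≡0⇒n≡0 (1 ∸ n) c0)) vf vg }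
    where
    prec-valid : ∀ n {f g} → 1 ≤ n → e ≡ pair 4 (pair f g) → Valid (isCode (pred n) f) →
                 Valid (isCode (suc n) g) → Valid (isCode n e)
    prec-valid (suc n) _ eq (f , eqf) (g , eqg) =
      prec f g , trans (#-prec f g) (trans (cong₂ (λ x y → pair 4 (pair x y)) eqf eqg) (sym eq))
  ... | 5 = guard (isCode n e) ts (dist e (pair 5 (π₂ e))) w (isCode (suc n) _ ∷ []) λ { c0 ((f , eqf) ∷ []) →
              mu f , trans (#-mu f) (trans (cong (pair 5) eqf) (sym (dist≡0⇒≡ _ _ c0))) }
  ... | 6 = guard (isCode n e) ts (dist n 1 + dist e (pair 6 0)) w [] λ c0 _ → oracle-valid n
              (dist≡0⇒≡ _ _ (m+n≡0⇒m≡0 (dist n 1) c0)) (dist≡0⇒≡ _ _ (m+n≡0⇒n≡0 (dist n 1) c0))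
    where
    oracle-valid : ∀ n → n ≡ 1 → e ≡ pair 6 0 → Valid (isCode n e)
    oracle-valid _ refl eq = oracle , trans #-oracle (sym eq)
  ... | suc (suc (suc (suc (suc (suc (suc _)))))) = inj₁ refl

  codesStep-outcome : ∀ n k e ts w → Outcome (isCodes n k e) ts w (codesStep n k e (encTasks ts) w)
  codesStep-outcome n zero    e ts w = guard (isCodes n 0 e) ts e w [] λ e0 _ → [] , trans #*-[] (sym e0)
  codesStep-outcome n (suc k) e ts w =
    guard (isCodes n (suc k) e) ts (dist e (pair (π₁ e) (π₂ e))) w (isCode n _ ∷ isCodes n k _ ∷ [])
      λ { c0 ((g , eqg) ∷ (gs , eqgs) ∷ []) →
          g ∷ gs , trans (#*-∷ g gs) (trans (cong₂ pair eqg eqgs) (sym (dist≡0⇒≡ _ _ c0))) }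

  step-outcome : ∀ t ts → Outcome t ts (encTasks (t ∷ ts)) (stepℕ (encTasks (t ∷ ts)))
  step-outcome (isCode n e) ts = subst (Outcome (isCode n e) ts _) (sym (stepℕ-isCode n e ts))
    (codeStep-outcome n e ts _)
  step-outcome (isCodes n k e) ts = subst (Outcome (isCodes n k e) ts _) (sym (stepℕ-isCodes n k e ts))
    (codesStep-outcome n k e ts _)

  -- Induction on `s`: a stuck step leaves the same list with less time, and otherwise the validity
  -- of the subtasks is handed back to the task that they replaced.
  check-sound : ∀ s ts → iterate stepℕ (encTasks ts) s ≡ 0 → List.All Valid ts
  check-sound s       []       eq = []
  check-sound zero    (t ∷ ts) eq = contradiction eq (pair≢0 _ _)
  check-sound (suc s) (t ∷ ts) eq with step-outcome t ts
  ... | inj₁ stuck = check-sound s (t ∷ ts) (trans (cong (λ x → iterate stepℕ x s) (sym stuck)) eq)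
  ... | inj₂ (subs , r , v)
    with check-sound s (subs ++ ts) (trans (cong (λ x → iterate stepℕ x s) (sym r)) eq)
  ... | vs = v (++⁻ˡ subs vs) ∷ ++⁻ʳ subs vs

  infix 4 _⇝_

  data _⇝_ (ts us : List Task) : Set where
    steps : ∀ s → iterate stepℕ (encTasks ts) s ≡ encTasks us → ts ⇝ us

  ⇝-trans : ∀ {ts us vs} → ts ⇝ us → us ⇝ vs → ts ⇝ vs
  ⇝-trans {ts} {us} (steps s p) (steps r q) =
    steps (s + r) (trans (iterate-+ (encTasks ts) s) (trans (cong (λ x → iterate stepℕ x r) p) q))
    where
    iterate-+ : ∀ x s → iterate stepℕ x (s + r) ≡ iterate stepℕ (iterate stepℕ x s) r
    iterate-+ x zero    = refl
    iterate-+ x (suc s) = iterate-+ (stepℕ x) s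

  mutual
    code-complete : (c : Code n) (ts : List Task) → isCode n (# c) ∷ ts ⇝ ts
    code-complete c ts = ⇝-trans (steps 1 $ trans (stepℕ-isCode _ (# c) ts) (first c _)) (rest c)
      where
      subtasks : Code n → List Task
      subtasks zer = []
      subtasks succ = []
      subtasks (proj i) = []
      subtasks {n} (comp {k = k} f gs) = isCode k (# f) ∷ isCodes n k (#* gs) ∷ []
      subtasks (prec {n = n} f g) = isCode n (# f) ∷ isCode (2 + n) (# g) ∷ []
      subtasks (mu {n = n} f) = isCode (suc n) (# f) ∷ []
      subtasks oracle = []

      first : (c : Code n) (w : ℕ) → codeStep n (# c) (encTasks ts) w ≡ encTasks (subtasks c ++ ts)
      first zer w rewrite #-zer | π₁-pair 0 0 | dist-refl (pair 0 0) = refl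
      first succ w rewrite #-succ | π₁-pair 1 0 | dist-refl (pair 1 0) = refl
      first {n} (proj i) w rewrite #-proj i | π₁-pair 2 (toℕ i) | π₂-pair 2 (toℕ i)
        | m≤n⇒m∸n≡0 (toℕ<n i) | dist-refl (pair 2 (toℕ i)) = refl
      first (comp {k = k} f gs) w rewrite #-comp f gs
        | π₁-pair 3 (pair k (pair (# f) (#* gs))) | π₂-pair 3 (pair k (pair (# f) (#* gs)))
        | π₁-pair k (pair (# f) (#* gs)) | π₂-pair k (pair (# f) (#* gs))
        | π₁-pair (# f) (#* gs) | π₂-pair (# f) (#* gs)
        | dist-refl (pair 3 (pair k (pair (# f) (#* gs)))) = refl
      first (prec {n = n} f g) w rewrite #-prec f g
        | π₁-pair 4 (pair (# f) (# g)) | π₂-pair 4 (pair (# f) (# g))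
        | π₁-pair (# f) (# g) | π₂-pair (# f) (# g)
        | 0∸n≡0 n | dist-refl (pair 4 (pair (# f) (# g))) = refl
      first (mu f) w rewrite #-mu f | π₁-pair 5 (# f) | π₂-pair 5 (# f)
        | dist-refl (pair 5 (# f)) = refl
      first oracle w rewrite #-oracle | π₁-pair 6 0 | dist-refl (pair 6 0) = refl

      rest : (c : Code n) → subtasks c ++ ts ⇝ ts
      rest zer = steps 0 refl
      rest succ = steps 0 refl
      rest (proj i) = steps 0 refl
      rest (comp f gs) = ⇝-trans (code-complete f _) (codes-complete gs ts)
      rest (prec f g) = ⇝-trans (code-complete f _) (code-complete g ts)
      rest (mu f) = code-complete f ts
      rest oracle = steps 0 refl

    codes-complete : (gs : Vec (Code n) k) (ts : List Task) → isCodes n k (#* gs) ∷ ts ⇝ ts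
    codes-complete {n} [] ts = steps 1 $ trans (stepℕ-isCodes n 0 _ ts) eq
      where
      eq : ifz (#* {n} []) (encTasks ts) (encTasks (isCodes n 0 (#* {n} []) ∷ ts)) ≡ encTasks ts
      eq rewrite #*-[] {n} = refl
    codes-complete {n} {suc k} (g ∷ gs) ts =
      ⇝-trans
        (steps 1 $ trans (stepℕ-isCodes n (suc k) _ ts) (eq _))
        (⇝-trans (code-complete g _) (codes-complete gs ts))
      where
      eq : ∀ w → codesStep n (suc k) (#* (g ∷ gs)) (encTasks ts) w ≡
           encTasks (isCode n (# g) ∷ isCodes n k (#* gs) ∷ ts)
      eq w rewrite #*-∷ g gs | π₁-pair (# g) (#* gs) | π₂-pair (# g) (#* gs)
                 | dist-refl (pair (# g) (#* gs)) = refl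

-- Indices of searches, computed from parameters.

numeralᵗ : Term X n → Term X n
numeralᵗ {X} t = fun≗ (recᵗ t (const (# {1} (numeral 0))) (pairᵗ (const 3)
    (pairᵗ (const 1) (pairᵗ (const (# succ)) (pairᵗ (var 1F) (const 0))))))
  (λ xs → # {1} (numeral (⟦ t ⟧ xs))) λ xs → eq (⟦ t ⟧ xs)
  where
  eq : ∀ x → natrec (# {1} (numeral 0)) (λ _ y → pair 3 (pair 1 (pair (# succ) (pair y 0)))) x
             ≡ # {1} (numeral x)
  eq zero    = refl
  eq (suc x) rewrite eq x = sym (trans (#-comp succ (numeral x ∷ []))
    (cong (λ y → pair 3 (pair 1 (pair (# succ) y)))
      (trans (#*-∷ (numeral x) []) (cong (pair (# (numeral x))) #*-[]))))

numeralsᵗ : ∀ n → Σ[ t ∈ Term X n ] ∀ xs → ⟦ t ⟧ xs ≡ #* {1} (map numeral xs)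
numeralsᵗ zero    = const (#* {1} []) , λ { [] → refl }
numeralsᵗ (suc n) with numeralsᵗ n
... | t , eq = pairᵗ (numeralᵗ (var 0F)) (t ⟪ dropˢ 1 ⟫) , λ { (x ∷ xs) →
  trans (cong (pair (# {1} (numeral x))) (eq xs)) (sym (#*-∷ (numeral x) (map numeral xs))) }

-- This program ignores its input, so it halts on its own index iff the
-- search for a witness succeeds.
searcher : Term X (suc n) → Vec ℕ n → Code 1
searcher t xs = comp (mu (code t)) (map numeral xs)

-- An s-m-n function. Assembling the index consults no oracle, so `Z` is arbitrary; `jumpᵗ` takes it
-- to be `X ′`.
searcherᵗ : Term X (suc n) → Term Z n
searcherᵗ {n = n} t = fun≗ (pairᵗ (const 3) (pairᵗ (const n)
    (pairᵗ (const (# (mu (code t)))) (proj₁ (numeralsᵗ n)))))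
  (λ xs → # (searcher t xs))
  λ xs → trans (cong (λ y → pair 3 (pair n (pair (# (mu (code t))) y))) (proj₂ (numeralsᵗ n) xs))
    (sym (#-comp (mu (code t)) (map numeral xs)))

infix 4 _∈Σ₁_

_∈Σ₁_ : Vec ℕ n → Term X (suc n) → Set
xs ∈Σ₁ t = ∃[ s ] ⟦ t ⟧ (s ∷ xs) ≡ 0

searcher-halts : (t : Term X (suc n)) {xs : Vec ℕ n} → xs ∈Σ₁ t →
                 ∀ e → ∃[ y ] X ⊢ searcher t xs [ e ∷ [] ]⇓ y
searcher-halts {X} t {xs} (s , t0) e with minimal (λ s → ⟦ t ⟧ (s ∷ xs)) s t0
... | m , tm , below = m , ⇓comp {ys = xs}
    (λ i → subst (λ c → X ⊢ c [ e ∷ [] ]⇓ lookup xs i) (sym (lookup-map i numeral xs))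
      (numeral-runs (lookup xs i) (e ∷ [])))
    (⇓mu (subst (X ⊢ code t [ m ∷ xs ]⇓_) tm (runs t (m ∷ xs))) λ l l<m → positive l (below l l<m))
  where
  positive : ∀ l → ⟦ t ⟧ (l ∷ xs) ≢ 0 → ∃[ y ] X ⊢ code t [ l ∷ xs ]⇓ suc y
  positive l ≢0 with ⟦ t ⟧ (l ∷ xs) | runs t (l ∷ xs)
  ... | zero  | _ = contradiction refl ≢0
  ... | suc y | d = y , d

halts-searcher : (t : Term X (suc n)) {xs : Vec ℕ n} → ∀ {e y} →
                 X ⊢ searcher t xs [ e ∷ [] ]⇓ y → xs ∈Σ₁ t
halts-searcher {X} t {xs} {e} (⇓comp {ys = ys} ds (⇓mu {m = m} d _))
  with refl ← lookup-ext ys xs (λ i → ⇓-det (ds i)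
    (subst (λ c → X ⊢ c [ e ∷ [] ]⇓ lookup xs i) (sym (lookup-map i numeral xs))
      (numeral-runs (lookup xs i) (e ∷ [])))) = m , ⇓-det (runs t (m ∷ xs)) d

-- Properties that hold from some stage on.

Eventually : (ℕ → Set) → Set
Eventually P = ∃[ s₀ ] ∀ s → s₀ ≤ s → P s

always : {P : ℕ → Set} → (∀ s → P s) → Eventually P
always p = 0 , λ s _ → p s

ev-map : {P Q : ℕ → Set} → (∀ s → P s → Q s) → Eventually P → Eventually Q
ev-map f (s₀ , p) = s₀ , λ s le → f s (p s le)

ev-× : {P Q : ℕ → Set} → Eventually P → Eventually Q → Eventually (λ s → P s × Q s)
ev-× (s₀ , p) (s₁ , q) = s₀ ⊔ s₁ , λ s le →
  p s (≤-trans (m≤m⊔n s₀ s₁) le) , q s (≤-trans (m≤n⊔m s₀ s₁) le)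

ev-vec : (v : ℕ → Vec ℕ n) (ys : Vec ℕ n) →
         (∀ i → Eventually λ s → lookup (v s) i ≡ lookup ys i) → Eventually λ s → v s ≡ ys
ev-vec {zero} v [] h = always λ s → lookup-ext (v s) [] λ ()
ev-vec {suc n} v (y ∷ ys) h =
  ev-map (λ s (p , q) → glue (v s) p q) (ev-× (h zero) (ev-vec (tail ∘ v) ys
    λ i → ev-map (λ s eq → trans (lookup-tail (v s) i) eq) (h (suc i))))
  where
  lookup-tail : ∀ {n} (w : Vec ℕ (suc n)) i → lookup (tail w) i ≡ lookup w (suc i)
  lookup-tail (_ ∷ _) i = refl
  glue : ∀ {n} {y} {ys : Vec ℕ n} (w : Vec ℕ (suc n)) → lookup w zero ≡ y → tail w ≡ ys → w ≡ y ∷ ys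
  glue (_ ∷ _) refl refl = refl

ev-< : {P : ℕ → ℕ → Set} → ∀ m → (∀ l → l < m → Eventually (P l)) →
       Eventually λ s → ∀ l → l < m → P l s
ev-< zero    h = always λ _ _ ()
ev-< {P} (suc m) h = ev-map both (ev-× (ev-< m λ l l<m → h l (m<n⇒m<1+n l<m)) (h m ≤-refl))
  where
  both : ∀ s → (∀ l → l < m → P l s) × P m s → ∀ l → l < suc m → P l s
  both s (p , q) l (s≤s l≤m) with m≤n⇒m<n∨m≡n l≤m
  ... | inj₁ l<m  = p l l<m
  ... | inj₂ refl = q

-- Running a code with a limit-computable oracle: the stage-s value is
-- total, and converges whenever the computation from the true oracle does.

module Stages {A Z : Pred ℕ 0ℓ} (approx : Term Z 2) where

  mutual
    stage : Code n → Term Z (suc n)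
    stage zer         = const 0
    stage succ        = sucᵗ (var 1F)
    stage (proj i)    = var (suc i)
    stage (comp f gs) = stage f ⟪ var 0F ∷ˢ stages gs ⟫
    -- In the step of the recursion the context is counter, previous value, stage, recursion
    -- argument, inputs; the substitution brings the stage back to the front.
    stage (prec f g)  = recᵗ (var 1F) (stage f ⟪ var 0F ∷ˢ dropˢ 2 ⟫)
                          (stage g ⟪ var 2F ∷ˢ var 0F ∷ˢ var 1F ∷ˢ dropˢ 4 ⟫)
    -- The stage bounds the search, which makes it total; the bound is harmless once it has reached
    -- the true root.
    stage (mu f)      = leastᵗ (var 0F) (stage f ⟪ var 1F ∷ˢ var 0F ∷ˢ dropˢ 2 ⟫)
    stage oracle      = approx

    stages : Vec (Code n) k → Sub Z (suc n) k
    stages []       = []ˢ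
    stages (g ∷ gs) = stage g ∷ˢ stages gs

  lookup-stages : (gs : Vec (Code n) k) → ∀ v i →
                  lookup (⟦ stages gs ⟧* v) i ≡ ⟦ stage (lookup gs i) ⟧ v
  lookup-stages (g ∷ gs) v zero    = refl
  lookup-stages (g ∷ gs) v (suc i) = lookup-stages gs v i

  Converges : Code n → Vec ℕ n → ℕ → Set
  Converges c xs y = Eventually λ s → ⟦ stage c ⟧ (s ∷ xs) ≡ y

  module _ (oracle-converges : ∀ {x y} → A ⊢ oracle [ x ∷ [] ]⇓ y → Converges oracle (x ∷ []) y) where

    -- A halting computation rests on finitely many subcomputations, even under `mu`, so their
    -- thresholds have a common bound.
    converges : {c : Code n} {xs : Vec ℕ n} {y : ℕ} → A ⊢ c [ xs ]⇓ y → Converges c xs y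
    converges ⇓zer  = always λ _ → refl
    converges ⇓succ = always λ _ → refl
    converges ⇓proj = always λ _ → refl
    converges (⇓comp {f = f} {gs} {xs} {ys} ds d) = ev-map
      (λ s (args , val) → trans (cong (λ v → ⟦ stage f ⟧ (s ∷ v)) args) val)
      (ev-× (ev-vec _ ys λ i → ev-map (λ s eq → trans (lookup-stages gs (s ∷ xs) i) eq) (converges (ds i)))
            (converges d))
    converges (⇓prec₀ d) = converges d
    converges (⇓precₛ {f = f} {g} {xs} {m} d e) = ev-map
      (λ s (p , q) → trans (cong (λ y → ⟦ stage g ⟧ (s ∷ m ∷ y ∷ xs)) p) q)
      (ev-× (converges d) (converges e))
    converges (⇓mu {f = f} {xs} {m} d h) = ev-map
      (λ s (m≤s , root , below) → least-≡ s (λ l → ⟦ stage f ⟧ (s ∷ l ∷ xs)) m m≤s root below)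
      (ev-× (m , λ _ → id) (ev-× (converges d)
        (ev-< m λ l l<m → ev-map (λ s eq eq0 → 1+n≢0 (trans (sym eq) eq0)) (converges (proj₂ (h l l<m))))))
    converges d@(⇓yes _) = oracle-converges d
    converges d@(⇓no _)  = oracle-converges d

-- Turing reductions as transformations of codes.

mutual
  reduce : Code 1 → Code n → Code n
  reduce r zer         = zer
  reduce r succ        = succ
  reduce r (proj i)    = proj i
  reduce r (comp f gs) = comp (reduce r f) (reduces r gs)
  reduce r (prec f g)  = prec (reduce r f) (reduce r g)
  reduce r (mu f)      = mu (reduce r f)
  reduce r oracle      = r

  reduces : Code 1 → Vec (Code n) k → Vec (Code n) k
  reduces r []       = []
  reduces r (g ∷ gs) = reduce r g ∷ reduces r gs

reduce-runs : ((r , _) : A ≤T B) {c : Code n} {xs : Vec ℕ n} {y : ℕ} →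
              A ⊢ c [ xs ]⇓ y → B ⊢ reduce r c [ xs ]⇓ y
reduce-runs R ⇓zer = ⇓zer
reduce-runs R ⇓succ = ⇓succ
reduce-runs R ⇓proj = ⇓proj
reduce-runs {B = B} R@(r , _) (⇓comp {gs = gs} {xs} {ys} ds d) = ⇓comp
  (λ i → subst (λ c → B ⊢ c [ xs ]⇓ lookup ys i) (sym (lookup-reduces gs i)) (reduce-runs R (ds i)))
  (reduce-runs R d)
  where
  lookup-reduces : ∀ {n k} (gs : Vec (Code n) k) i → lookup (reduces r gs) i ≡ reduce r (lookup gs i)
  lookup-reduces (g ∷ gs) zero    = refl
  lookup-reduces (g ∷ gs) (suc i) = lookup-reduces gs i
reduce-runs R (⇓prec₀ d) = ⇓prec₀ (reduce-runs R d)
reduce-runs R (⇓precₛ d e) = ⇓precₛ (reduce-runs R d) (reduce-runs R e)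
reduce-runs R (⇓mu d h) = ⇓mu (reduce-runs R d)
  λ l l<m → proj₁ (h l l<m) , reduce-runs R (proj₂ (h l l<m))
reduce-runs R (⇓yes x∈A) = proj₁ (proj₂ R _) x∈A
reduce-runs R (⇓no x∉A) = proj₂ (proj₂ R _) x∉A

infixl 8 _via_

-- The function stays literally the same, so facts about it survive the change of oracle.
_via_ : Term A n → A ≤T B → Term B n
t via R@(r , _) = term ⟦ t ⟧ (reduce r (code t)) λ xs → reduce-runs R (runs t xs)

-- The universal relation and the jump.

module Jump (em : ExcludedMiddle 0ℓ) where

  memberᵗ : Term X n → Term X n
  memberᵗ t = negᵗ (χᵗ em t)

  member-sound : ∀ X x → neg (χ em X x) ≡ 0 → x ∈ X
  member-sound X x eq with em {x ∈ X}
  ... | yes x∈X = x∈X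
  ... | no _    = contradiction eq λ ()

  member-complete : ∀ X x → x ∈ X → neg (χ em X x) ≡ 0
  member-complete X x x∈X with em {x ∈ X}
  ... | yes _   = refl
  ... | no  x∉X = contradiction x∈X x∉X

  decided⇒≤T : (t : Term B 1) → (∀ x → x ∈ A → ⟦ t ⟧ (x ∷ []) ≡ 0) →
               (∀ x → ⟦ t ⟧ (x ∷ []) ≡ 0 → x ∈ A) → A ≤T B
  decided⇒≤T {B} t complete sound = code (negᵗ t) , λ x →
    (λ x∈A → subst (λ y → B ⊢ code (negᵗ t) [ x ∷ [] ]⇓ neg y) (complete x x∈A) (runs (negᵗ t) (x ∷ []))) ,
    (λ x∉A → subst (B ⊢ code (negᵗ t) [ x ∷ [] ]⇓_) (≢0⇒neg≡0 _ (x∉A ∘ sound x)) (runs (negᵗ t) (x ∷ [])))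

  Computes : Pred ℕ 0ℓ → (e x y : ℕ) → Set
  Computes X e x y = Σ[ c ∈ Code 1 ] # c ≡ e × X ⊢ c [ x ∷ [] ]⇓ y

  opaque
    -- Kleene's T predicate. The witness `s` pairs two step counts: one for emptying the task list
    -- of the checker, one for bringing the evaluator to its final state with output `y`.
    universalᵗ : Term X 4
    universalᵗ {X} =
        iterateᵗ (π₁ᵗ s) (pairᵗ (pairᵗ (const 0) (pairᵗ (const 1) (pairᵗ (const 0) e))) (const 0)) (Checker.stepᵗ X)
        +ᵗ distᵗ (iterateᵗ (π₂ᵗ s) (stateᵗ (const 0) e (pairᵗ x (const 0)) (pairᵗ (const 0) (const 0)))
                   (Machine.stepᵗ em X))
                 (stateᵗ (const 2) y (const 0) (pairᵗ (const 0) (const 0)))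
      where
      s e x y : Term X 4
      s = var 0F
      e = var 1F
      x = var 2F
      y = var 3F

    universal-sound : ∀ {e x y} → e ∷ x ∷ y ∷ [] ∈Σ₁ universalᵗ {X} → Computes X e x y
    universal-sound {X} {e} {x} {y} (s , eq)
      with Checker.check-sound X (π₁ s) (isCode 1 e ∷ []) (m+n≡0⇒m≡0 checked eq)
      where
      checked : ℕ
      checked = iterate (Checker.stepℕ X) (encTasks (isCode 1 e ∷ [])) (π₁ s)
    ... | (c , refl) ∷ [] = c , refl , Machine.halts⇒⇓ em X (π₂ s) c x y
      (dist≡0⇒≡ _ _ (m+n≡0⇒n≡0 (iterate (Checker.stepℕ X) (encTasks (isCode 1 e ∷ [])) (π₁ s)) eq))

    universal-complete : ∀ {e x y} → Computes X e x y → e ∷ x ∷ y ∷ [] ∈Σ₁ universalᵗ {X}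
    universal-complete {X} {_} {x} {y} (c , refl , d)
      with Checker.code-complete X c [] | Machine.⇓⇒halts em X d
    ... | Checker.steps s₁ checked | s₂ , halted = pair s₁ s₂ , eq
      where
      eq : ⟦ universalᵗ {X} ⟧ (pair s₁ s₂ ∷ # c ∷ x ∷ y ∷ []) ≡ 0
      eq rewrite π₁-pair s₁ s₂ | π₂-pair s₁ s₂ | checked | halted = dist-refl (Machine.final em X y)

  -- The witness carries the output along with the run, since membership in the jump leaves the
  -- output open.
  haltsᵗ : Term X 2
  haltsᵗ = universalᵗ ⟪ π₁ᵗ (var 0F) ∷ˢ var 1F ∷ˢ var 1F ∷ˢ π₂ᵗ (var 0F) ∷ˢ []ˢ ⟫

  halts-sound : ∀ {e} → e ∷ [] ∈Σ₁ haltsᵗ {X} → e ∈ X ′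
  halts-sound (p , eq) with universal-sound (π₁ p , eq)
  ... | c , refl , d = c , #-≡ c , π₂ p , d

  halts-complete : ∀ {e} → e ∈ X ′ → e ∷ [] ∈Σ₁ haltsᵗ {X}
  halts-complete {X} {e} (c , eqc , y , d) with universal-complete (c , trans (sym (#-≡ c)) eqc , d)
  ... | s , eq = pair s y , trans
    (cong₂ (λ s y → ⟦ universalᵗ {X} ⟧ (s ∷ e ∷ e ∷ y ∷ [])) (π₁-pair s y) (π₂-pair s y)) eq

  opaque
    -- One level of Post's theorem: to decide an existential statement, `X ′` is asked about the
    -- index of the search for a witness.
    jumpᵗ : Term X (suc n) → Term (X ′) n
    jumpᵗ t = memberᵗ (searcherᵗ t)

    jump-sound : (t : Term X (suc n)) {xs : Vec ℕ n} → ⟦ jumpᵗ t ⟧ xs ≡ 0 → xs ∈Σ₁ t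
    jump-sound {X} t {xs} eq with member-sound (X ′) (# (searcher t xs)) eq
    ... | c , eqc , y , d
      with refl ← #-injective c (searcher t xs) (trans (sym (#-≡ c)) eqc) = halts-searcher t d

    jump-complete : (t : Term X (suc n)) {xs : Vec ℕ n} → xs ∈Σ₁ t → ⟦ jumpᵗ t ⟧ xs ≡ 0
    jump-complete {X} t {xs} xs∈ = member-complete (X ′) (# (searcher t xs))
      (searcher t xs , #-≡ _ , searcher-halts t xs∈ (# (searcher t xs)))

  jump-mono : A ≤T B → A ′ ≤T B ′
  jump-mono R = decided⇒≤T (jumpᵗ (haltsᵗ via R))
    (λ x → jump-complete (haltsᵗ via R) ∘ halts-complete)
    (λ x → halts-sound ∘ jump-sound (haltsᵗ via R))

  ≤T-⊕ˡ : A ≤T A ⊕ B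
  ≤T-⊕ˡ {A} {B} = decided⇒≤T (memberᵗ (const 2 *ᵗ var 0F))
    (λ x x∈A → member-complete (A ⊕ B) (2 * x) (inj₁ (x , refl , x∈A)))
    λ x → left x ∘ member-sound (A ⊕ B) (2 * x)
    where
    left : ∀ x → 2 * x ∈ A ⊕ B → x ∈ A
    left x (inj₁ (a , eq , a∈A)) = subst A (sym (*-cancelˡ-≡ x a 2 eq)) a∈A
    left x (inj₂ (b , eq , _))   = contradiction eq (even≢odd x b)

  ≤T-⊕ʳ : B ≤T A ⊕ B
  ≤T-⊕ʳ {B} {A} = decided⇒≤T (memberᵗ (sucᵗ (const 2 *ᵗ var 0F)))
    (λ x x∈B → member-complete (A ⊕ B) (suc (2 * x)) (inj₂ (x , refl , x∈B)))
    λ x → right x ∘ member-sound (A ⊕ B) (suc (2 * x))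
    where
    right : ∀ x → suc (2 * x) ∈ A ⊕ B → x ∈ B
    right x (inj₁ (a , eq , _))   = contradiction (sym eq) (even≢odd a x)
    right x (inj₂ (b , eq , b∈B)) = subst B (sym (*-cancelˡ-≡ x b 2 (suc-injective eq))) b∈B

  -- The limit lemma

  approxᵗ : Term Z 2
  -- An unsuccessful search returns its bound, so the number found is tested once more; `negᵗ`
  -- converts the truth value 0 into the oracle answer 1.
  approxᵗ = negᵗ (haltsᵗ ⟪ leastᵗ (var 0F) (haltsᵗ ⟪ var 0F ∷ˢ var 2F ∷ˢ []ˢ ⟫) ∷ˢ var 1F ∷ˢ []ˢ ⟫)

  approx-converges : ∀ {x y} → Z ′ ⊢ oracle [ x ∷ [] ]⇓ y →
                     Eventually λ s → ⟦ approxᵗ {Z} ⟧ (s ∷ x ∷ []) ≡ y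
  approx-converges {Z} {x} (⇓yes x∈Z′) with halts-complete x∈Z′
  ... | s , halted with minimal (λ s → ⟦ haltsᵗ {Z} ⟧ (s ∷ x ∷ [])) s halted
  ... | m , found , below = m , λ s m≤s →
    cong neg (trans (cong (λ l → ⟦ haltsᵗ {Z} ⟧ (l ∷ x ∷ [])) (least-≡ s _ m m≤s found below)) found)
  approx-converges {Z} {x} (⇓no x∉Z′) = always λ s →
    ≢0⇒neg≡0 _ λ eq → x∉Z′ (halts-sound (_ , eq))

  opaque
    limitᵗ : Term (Z ′) n → Term Z (suc n)
    limitᵗ {Z} t = Stages.stage {Z ′} approxᵗ (code t)

    limit-converges : (t : Term (Z ′) n) (xs : Vec ℕ n) →
                      Eventually λ s → ⟦ limitᵗ t ⟧ (s ∷ xs) ≡ ⟦ t ⟧ xs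
    limit-converges {Z} t xs = Stages.converges {Z ′} approxᵗ approx-converges (runs t xs)

-- Increasing tuples and omitted colors.

Linked-∷ʳ : ∀ {s} (σ : Vec ℕ (suc n)) → Linked _<_ σ → last σ < s → Linked _<_ (σ ∷ʳ s)
Linked-∷ʳ (x ∷ [])    _         x<s = x<s ∷ [-]
Linked-∷ʳ (x ∷ y ∷ σ) (x<y ∷ l) σ<s = x<y ∷ Linked-∷ʳ (y ∷ σ) l σ<s

All-∷ʳ : ∀ {s} {σ : Vec ℕ n} → All A σ → s ∈ A → All A (σ ∷ʳ s)
All-∷ʳ []        s∈A = s∈A ∷ []
All-∷ʳ (px ∷ ps) s∈A = px ∷ All-∷ʳ ps s∈A

Avoids : Pred ℕ 0ℓ → ℕ → Term Z n → Set
Avoids A v t = ∀ σ → Linked _<_ σ → All A σ → ⟦ t ⟧ σ ≢ v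

module _ (em : ExcludedMiddle 0ℓ) where

  open Jump em

  -- Colorings as iterated limits

  limitʳ : Term (Z ′) n → Term Z (suc n)
  -- Stability concerns the last coordinate, so the stage moves from the front to the end.
  limitʳ t = limitᵗ t ⟪ lastᵗ ∷ˢ initˢ ⟫

  limitʳ-converges : (t : Term (Z ′) n) (xs : Vec ℕ n) →
                     Eventually λ s → ⟦ limitʳ t ⟧ (xs ∷ʳ s) ≡ ⟦ t ⟧ xs
  limitʳ-converges t xs = ev-map
    (λ s eq → trans (cong₂ (λ y ys → ⟦ limitᵗ t ⟧ (y ∷ ys)) (last-∷ʳ s xs) (init-∷ʳ s xs)) eq)
    (limit-converges t xs)

  -- A tuple from `A` with color `v` could be extended by an element of `A` so large that the tuple
  -- stays increasing and the limit is already attained.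
  limitʳ-avoids : (t : Term (Z ′) (suc n)) {v : ℕ} →
                  Infinite A → Avoids A v (limitʳ t) → Avoids A v t
  limitʳ-avoids t A∞ av σ linked all eq with limitʳ-converges t σ
  ... | s₀ , lim with A∞ (s₀ ⊔ suc (last σ))
  ... | s , s≥ , s∈A = av (σ ∷ʳ s)
    (Linked-∷ʳ σ linked (≤-trans (m≤n⊔m s₀ _) s≥)) (All-∷ʳ all s∈A)
    (trans (lim s (≤-trans (m≤m⊔n s₀ _) s≥)) eq)

  Stabilises : Term ∅ (suc n) → Set
  Stabilises t = ∀ σ → ∃[ v ] Eventually λ s → ⟦ t ⟧ (σ ∷ʳ s) ≡ v

  -- Each limit trades one jump for one more coordinate, which keeps their sum at `2 + l`. Stability
  -- comes from the limit taken last, whose stage is the last coordinate.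
  iterated-limit : ∀ n k (t : Term (∅ ⁽ suc n ⁾) (suc k)) → n + k ≡ l →
                   Σ[ h ∈ Term ∅ (2 + l) ] Stabilises h ×
                   ∀ {A v} → Infinite A → Avoids A v h → Avoids A v t
  iterated-limit zero k t refl =
    limitʳ t , (λ σ → ⟦ t ⟧ σ , limitʳ-converges t σ) , limitʳ-avoids t
  iterated-limit (suc n) k t eq with iterated-limit n (suc k) (limitʳ t) (trans (+-suc n k) eq)
  ... | h , st , av = h , st , λ A∞ → limitʳ-avoids t A∞ ∘ av A∞

  omitted : (g : Coloring k) → Thin g A → ∃[ v ] v ∉ image g A
  omitted {A = A} g thin with em {∃[ v ] v ∉ image g A}
  ... | yes found = found
  ... | no  none  = contradiction universal thin
    where
    universal : ∀ v → v ∈ image g A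
    universal v with em {v ∈ image g A}
    ... | yes v∈ = v∈
    ... | no  v∉ = contradiction (v , v∉) none

  bounds-thin : X Bounds STS[2+ n ] → (f : Term (∅ ⁽ suc n ⁾) 1) →
                ∃[ A ] A ≤T X × Infinite A × ∃[ v ] ∀ x → x ∈ A → ⟦ f ⟧ (x ∷ []) ≢ v
  bounds-thin {X} {n} bounds f with iterated-limit n 0 f (+-identityʳ n)
  ... | h , st , av with bounds (g , stable) (code h , λ σ → runs h (value σ))
    where
    g : Coloring (2 + n)
    g σ = ⟦ h ⟧ (value σ)
    stable : Stable g
    stable σ with st (value σ)
    ... | v , s₀ , lim = v , s₀ , λ s s₀≤s _ → lim s s₀≤s
  ... | A , A≤X , A∞ , thin with omitted _ thin
  ... | v , v∉ = A , A≤X , A∞ , v , λ x x∈A → av A∞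
    (λ σ linked all eq → v∉ ((σ , [ linked ]) , all , eq)) (x ∷ []) [-] (x∈A ∷ [])

  term-computes : (t : Term X 1) (x : ℕ) → Computes X (# (code t)) x (⟦ t ⟧ (x ∷ []))
  term-computes t x = code t , refl , runs t (x ∷ [])

  computes-det : (t : Term X 1) {x y : ℕ} → Computes X (# (code t)) x y → ⟦ t ⟧ (x ∷ []) ≡ y
  computes-det t {x} (c , eq , d) with refl ← #-injective c (code t) eq = ⇓-det (runs t (x ∷ [])) d

  -- The function that guesses a value it omits.

  module Diagonal (X Y : Pred ℕ 0ℓ) (low : X Low₂Over Y) where

    W : Pred ℕ 0ℓ
    W = X ⊕ Y

    -- Opacity keeps the codes of these terms from being normalised.
    opaque
      -- The `e`-th c.e. set consists of the inputs on which program `e` outputs 1, so the code in a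
      -- proof of `A ≤T X` is an index of `A`. The witness `p` pairs a run with the element that it
      -- enumerates.
      largeᵗ : Term W 3
      largeᵗ = (universalᵗ {X} via ≤T-⊕ˡ) ⟪ π₁ᵗ p ∷ˢ var 1F ∷ˢ π₂ᵗ p ∷ˢ const 1 ∷ˢ []ˢ ⟫
               +ᵗ (var 2F ∸ᵗ π₂ᵗ p)
        where
        p : Term W 3
        p = var 0F

      largeᵗ-≡ : ∀ p e m → ⟦ largeᵗ ⟧ (p ∷ e ∷ m ∷ []) ≡
                 ⟦ universalᵗ {X} ⟧ (π₁ p ∷ e ∷ π₂ p ∷ 1 ∷ []) + (m ∸ π₂ p)
      largeᵗ-≡ p e m = refl

      memberOfᵗ : Term W 3
      memberOfᵗ = (universalᵗ {X} via ≤T-⊕ˡ) ⟪ var 0F ∷ˢ var 1F ∷ˢ var 2F ∷ˢ const 1 ∷ˢ []ˢ ⟫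

      memberOfᵗ-≡ : ∀ s e m → ⟦ memberOfᵗ ⟧ (s ∷ e ∷ m ∷ []) ≡
                    ⟦ universalᵗ {X} ⟧ (s ∷ e ∷ m ∷ 1 ∷ [])
      memberOfᵗ-≡ s e m = refl

    large mem : (e m : ℕ) → ℕ
    large e m = ⟦ jumpᵗ largeᵗ ⟧ (e ∷ m ∷ [])
    mem   e m = ⟦ jumpᵗ memberOfᵗ ⟧ (e ∷ m ∷ [])

    -- The `a`-th function at `m` is program `a` on `pair a m`: the program is told its own index,
    -- which is what later allows self-reference.
    takes : (a t m i : ℕ) → ℕ
    takes a t m i = ⟦ universalᵗ {Y ′} ⟧ (t ∷ a ∷ pair a m ∷ i ∷ [])

    -- m and t refute u = ⟨ e , i ⟩ if the e-th X-c.e. set has no element ≥ m, or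
    -- contains m while the a-th function is seen by stage t to map m to i.
    refutes : (a u m t : ℕ) → ℕ
    refutes a u m t = neg (large (π₁ u) m) * (mem (π₁ u) m + takes a t m (π₂ u))

    opaque
      -- The questions about c.e. sets are Σ₁ over `W`, and a run over `Y ′` moves to `W ′` by
      -- monotonicity of the jump. The existence of a refutation is then a single question to
      -- `W ′ ′`.
      refutesᵗ : Term (W ′) 3
      refutesᵗ = negᵗ (jumpᵗ largeᵗ ⟪ e ∷ˢ x ∷ˢ []ˢ ⟫)
             *ᵗ (jumpᵗ memberOfᵗ ⟪ e ∷ˢ x ∷ˢ []ˢ ⟫
                 +ᵗ (universalᵗ {Y ′} via jump-mono ≤T-⊕ʳ) ⟪ t ∷ˢ a ∷ˢ pairᵗ a x ∷ˢ i ∷ˢ []ˢ ⟫)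
        where
        x t a e i : Term (W ′) 3
        x = π₁ᵗ (var 0F)
        t = π₂ᵗ (var 0F)
        a = var 1F
        e = π₁ᵗ (var 2F)
        i = π₂ᵗ (var 2F)

      refutesᵗ-≡ : ∀ w a u → ⟦ refutesᵗ ⟧ (w ∷ a ∷ u ∷ []) ≡ refutes a u (π₁ w) (π₂ w)
      refutesᵗ-≡ w a u = refl

      -- Lowness enters here, bringing that question from `W ′ ′` down to `Y ′ ′`.
      goodᵗ : Term (Y ′ ′) 2
      goodᵗ = negᵗ (jumpᵗ refutesᵗ via low)

      goodᵗ-≡ : ∀ a u → ⟦ goodᵗ ⟧ (a ∷ u ∷ []) ≡ neg (⟦ jumpᵗ refutesᵗ ⟧ (a ∷ u ∷ []))
      goodᵗ-≡ a u = refl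

      guessᵗ : Term (Y ′) 1
      -- The input is read as `pair a s`. The stage `s` also bounds the search, and any fixed
      -- candidate eventually comes within reach.
      guessᵗ = π₂ᵗ (leastᵗ (π₂ᵗ (var 0F))
        (limitᵗ goodᵗ ⟪ π₂ᵗ (var 1F) ∷ˢ π₁ᵗ (var 1F) ∷ˢ var 0F ∷ˢ []ˢ ⟫))

      guessᵗ-≡ : ∀ z → ⟦ guessᵗ ⟧ (z ∷ []) ≡
                 π₂ (least (π₂ z) λ u → ⟦ limitᵗ goodᵗ ⟧ (π₂ z ∷ π₁ z ∷ u ∷ []))
      guessᵗ-≡ z = refl

    self : ℕ
    self = # (code guessᵗ)

    -- With the index of `guessᵗ` as first component, this is exactly the `self`-th function in the
    -- sense of `takes`; its argument doubles as the stage.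
    fᵗ : Term (Y ′) 1
    fᵗ = guessᵗ ⟪ pairᵗ (const self) (var 0F) ∷ˢ []ˢ ⟫

    f : ℕ → ℕ
    f x = ⟦ fᵗ ⟧ (x ∷ [])

    f-≡ : ∀ x → f x ≡ π₂ (least x λ u → ⟦ limitᵗ goodᵗ ⟧ (x ∷ self ∷ u ∷ []))
    f-≡ x = trans (guessᵗ-≡ (pair self x))
      (cong₂ (λ a s → π₂ (least s λ u → ⟦ limitᵗ goodᵗ ⟧ (s ∷ a ∷ u ∷ [])))
        (π₁-pair self x) (π₂-pair self x))

    f-computes : ∀ x → Computes (Y ′) self (pair self x) (f x)
    f-computes x = term-computes guessᵗ (pair self x)

    computes-f : ∀ {x v} → Computes (Y ′) self (pair self x) v → f x ≡ v
    computes-f {x} = computes-det guessᵗ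

    Good : ℕ → Set
    Good u = ⟦ goodᵗ ⟧ (self ∷ u ∷ []) ≡ 0

    Unbounded : ℕ → Set
    Unbounded e = ∀ m → ∃[ x ] m ≤ x × Computes X e x 1

    Misses : ℕ → ℕ → Set
    Misses e i = ∀ x → Computes X e x 1 → f x ≢ i

    not-refuted : ∀ {u} → Good u → ∀ m t → refutes self u m t ≢ 0
    not-refuted {u} good m t eq = neg≡0⇒≢0 _ (trans (sym (goodᵗ-≡ self u)) good)
      (jump-complete refutesᵗ {self ∷ u ∷ []} (pair m t , trans (refutesᵗ-≡ (pair m t) self u)
        (trans (cong₂ (refutes self u) (π₁-pair m t) (π₂-pair m t)) eq)))

    good⇒unbounded : ∀ {u} → Good u → Unbounded (π₁ u)
    good⇒unbounded {u} good m with large (π₁ u) m in eq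
    ... | zero with jump-sound largeᵗ {π₁ u ∷ m ∷ []} eq
    ...   | p , eq′ = π₂ p , m∸n≡0⇒m≤n (m+n≡0⇒n≡0 element sum0) ,
                      universal-sound (π₁ p , m+n≡0⇒m≡0 element sum0)
      where
      element : ℕ
      element = ⟦ universalᵗ {X} ⟧ (π₁ p ∷ π₁ u ∷ π₂ p ∷ 1 ∷ [])
      sum0 : element + (m ∸ π₂ p) ≡ 0
      sum0 = trans (sym (largeᵗ-≡ p (π₁ u) m)) eq′
    -- With no element from `m` on, the first factor of `refutes` vanishes, so `m` refutes `u` at
    -- any stage, such as 0.
    good⇒unbounded {u} good m | suc l = contradiction
      (cong (_* rest) (trans (cong neg eq) (0∸n≡0 l))) (not-refuted good m 0)
      where
      rest : ℕ
      rest = mem (π₁ u) m + takes self 0 m (π₂ u)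

    good⇒misses : ∀ {u} → Good u → Misses (π₁ u) (π₂ u)
    good⇒misses {u} good x x∈ fx≡ with universal-complete x∈ | universal-complete
      (subst (Computes (Y ′) self (pair self x)) fx≡ (f-computes x))
    ... | s , eq′ | t , eq = not-refuted good x t (trans
      (cong (neg (large (π₁ u) x) *_)
        (cong₂ _+_ (jump-complete memberOfᵗ {π₁ u ∷ x ∷ []} (s , trans (memberOfᵗ-≡ s (π₁ u) x) eq′)) eq))
      (*-zeroʳ (neg (large (π₁ u) x))))

    not-refutes : ∀ {e i} → Unbounded e → Misses e i → ∀ m t →
                  neg (large e m) * (mem e m + takes self t m i) ≢ 0
    not-refutes {e} {i} unb miss m t eq with m*n≡0⇒m≡0∨n≡0 (neg (large e m)) eq
    ... | inj₁ neg0 with unb m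
    ...   | x , m≤x , x∈ with universal-complete x∈
    ...     | s , eq′ = neg≡0⇒≢0 _ neg0 (jump-complete largeᵗ {e ∷ m ∷ []}
                (pair s x , trans (largeᵗ-≡ (pair s x) e m) eq″))
      where
      eq″ : ⟦ universalᵗ {X} ⟧ (π₁ (pair s x) ∷ e ∷ π₂ (pair s x) ∷ 1 ∷ []) + (m ∸ π₂ (pair s x)) ≡ 0
      eq″ rewrite π₁-pair s x | π₂-pair s x | eq′ = m≤n⇒m∸n≡0 m≤x
    not-refutes {e} {i} unb miss m t eq | inj₂ sum0
      with jump-sound memberOfᵗ {e ∷ m ∷ []} (m+n≡0⇒m≡0 (mem e m) sum0)
    ... | s , eq′ = miss m (universal-sound (s , trans (sym (memberOfᵗ-≡ s e m)) eq′))
      (computes-f (universal-sound (t , m+n≡0⇒n≡0 (mem e m) sum0)))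

    good-intro : ∀ {e i} → Unbounded e → Misses e i → Good (pair e i)
    good-intro {e} {i} unb miss = trans (goodᵗ-≡ self (pair e i)) (≢0⇒neg≡0 _ λ eq →
      unrefuted (jump-sound refutesᵗ {self ∷ pair e i ∷ []} eq))
      where
      unrefuted : ¬ (self ∷ pair e i ∷ [] ∈Σ₁ refutesᵗ)
      unrefuted (w , eq) = not-refutes unb miss (π₁ w) (π₂ w) (trans
        (cong₂ (λ e i → neg (large e (π₁ w)) * (mem e (π₁ w) + takes self (π₂ w) (π₁ w) i))
          (sym (π₁-pair e i)) (sym (π₂-pair e i)))
        (trans (sym (refutesᵗ-≡ w self (pair e i))) eq))

    -- Only finitely many candidates precede the least good one. Once the approximations to all of
    -- them and to it have settled, the search stops exactly there.
    f-limit : ∃[ u ] Good u → ∃[ u ] Good u × Eventually λ s → f s ≡ π₂ u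
    f-limit (u , good) with minimal (λ u → ⟦ goodᵗ ⟧ (self ∷ u ∷ [])) u good
    ... | u₀ , good₀ , below = u₀ , good₀ , ev-map
      (λ s (u₀≤s , found , earlier) → trans (f-≡ s) (cong π₂ (least-≡ s _ u₀ u₀≤s found earlier)))
      (ev-× (u₀ , λ _ → id) (ev-×
        (ev-map (λ s eq → trans eq good₀) (limit-converges goodᵗ (self ∷ u₀ ∷ [])))
        (ev-< u₀ λ l l<u₀ → ev-map (λ s eq eq0 → below l l<u₀ (trans (sym eq) eq0))
          (limit-converges goodᵗ (self ∷ l ∷ [])))))

    -- An unbounded set has an element past the threshold of convergence, where `f` takes the very
    -- value that it should miss.
    none-good : ∀ u → ¬ Good u
    none-good u good with f-limit (u , good)
    ... | u₀ , good₀ , s₀ , lim with good⇒unbounded good₀ s₀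
    ... | x , s₀≤x , x∈ = good⇒misses good₀ x x∈ (lim x s₀≤x)

    -- The reduction of `A` to `X`, read as an index, and the omitted value would together be a good
    -- pair.
    no-thin : ∀ A v → A ≤T X → Infinite A → ¬ (∀ x → x ∈ A → f x ≢ v)
    no-thin A v (c , decides) A∞ avoids = none-good (pair (# c) v) (good-intro unbounded misses)
      where
      unbounded : Unbounded (# c)
      unbounded m with A∞ m
      ... | x , m≤x , x∈A = x , m≤x , c , refl , proj₁ (decides x) x∈A
      misses : Misses (# c) v
      misses x (c′ , eq , d) with refl ← #-injective c′ c eq with em {x ∈ A}
      ... | yes x∈A = avoids x x∈A
      ... | no  x∉A = contradiction (⇓-det d (proj₂ (decides x) x∉A)) λ ()

theorem4p8 : ExcludedMiddle 0ℓ →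
    ∀ (n : ℕ) →
    ¬ (Σ[ X ∈ Pred ℕ 0ℓ ] (X Low₂Over (∅ ⁽ n ⁾)) × (X Bounds STS[2+ n ]))
theorem4p8 em n (X , low , bounds) with bounds-thin em bounds (Diagonal.fᵗ em X (∅ ⁽ n ⁾) low)
... | A , A≤X , A∞ , v , avoids = Diagonal.no-thin em X (∅ ⁽ n ⁾) low A v A≤X A∞ avoids
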